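{- Let $G$ be a finite simple polyhedral map on a closed surface $\mathbb{M}$ with Euler characteristic $\chi(\mathbb{M}) \le 0$. If $G$ has more than $126|\chi(\mathbb{M})|$ vertices, then $G$ contains a vertex $v$ of degree $n \in \{3,4,5,6\}$ such that the multiset $\{a_1,\ldots,a_n\}$ of degrees of the faces incident with $v$ is one of the following (here "$\forall$" means the corresponding face may have any degree, and "$\le 2518$" means that face has degree at most $2518$): (1) $n=3$: $(3,3,\forall)$, $(3,4,\forall)$, $(3,5,\forall)$, $(3,6,\le 2518)$, $(3,7,\le 2518)$, $(3,8,\le 2518)$, $(3,9,\le 2518)$, $(3,10,\le 2518)$, $(3,11,\le 2518)$, $(3,12,\le 2518)$, $(4,4,\forall)$, $(4,5,\le 2518)$, $(4,6,\le 2518)$, $(4,7,\le 2518)$, $(4,8,\le 2518)$, $(5,5,\le 2518)$, $(5,6,\le 2518)$, $(6,6,6)$; (2) $n=4$: $(3,3,3,\forall)$, $(3,3,4,\le 2518)$, $(3,3,5,\le 2518)$, $(3,3,6,6)$, $(3,4,4,4)$, $(3,4,4,5)$, $(3,4,4,6)$, $(4,4,4,4)$; (3) $n=5$: $(3,3,3,3,3)$, $(3,3,3,3,4)$, $(3,3,3,3,5)$, $(3,3,3,3,6)$, $(3,3,3,4,4)$; (4) $n=6$: $(3,3,3,3,3,3)$.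
   Context: Graphs are finite, simple, undirected and connected. The orientable surface $\mathbb{S}_g$ (sphere with $g$ handles) has Euler characteristic $2-2g$; the non-orientable surface $\mathbb{N}_q$ (sphere with $q$ crosscaps) has Euler characteristic $2-q$. For a graph $G$ embedded in a surface $\mathbb{M}$, the faces are the connected components of $\mathbb{M}-G$; the embedding is a $2$-cell embedding if every face is an open disc. A map on $\mathbb{M}$ is a $2$-cell embedded graph in which every vertex has degree at least $3$. The representativity (face-width) of a $2$-cell embedding is the smallest number $k$ such that $\mathbb{M}$ contains a non-contractible closed curve meeting $G$ in exactly $k$ points. A polyhedral map is a map that is $3$-connected and whose embedding has representativity at least $3$. The facial walk of a face is the shortest closed walk following the edges around its boundary, and the degree of a face is the length of its facial walk. A vertex $v$ is called an $(a_1,\ldots,a_n)$-vertex if the faces incident with $v$ have degrees $a_1,\ldots,a_n$. -}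

module Defs where

open import Data.Nat using (ℕ; zero; suc; _+_; _*_; _≤_; _<_; _<?_; _/_)
open import Data.Integer as ℤ using (ℤ; +_; ∣_∣)
open import Data.Fin using (Fin; toℕ; _≟_)
open import Data.List using (List; []; _∷_; _++_; map; filter; length; allFin)
open import Data.List.Relation.Unary.All using (All)
open import Data.List.Relation.Binary.Pointwise using (Pointwise)
open import Data.List.Relation.Binary.Permutation.Propositional using (_↭_)
open import Data.Product using (Σ; ∃; _×_; _,_; proj₁; proj₂)
open import Data.Sum using (_⊎_)
open import Data.Unit using (⊤)
open import Relation.Nullary using (¬_)
open import Relation.Nullary.Decidable using (_×-dec_)
open import Relation.Binary.PropositionalEquality using (_≡_; _≢_)

-- Orbits of a set of permutations (generated by involutions, so the
-- forward closure is already symmetric).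

data Orb₂ {n : ℕ} (f g : Fin n → Fin n) (x : Fin n) : Fin n → Set where
  here : Orb₂ f g x x
  by-f : ∀ {y} → Orb₂ f g x y → Orb₂ f g x (f y)
  by-g : ∀ {y} → Orb₂ f g x y → Orb₂ f g x (g y)

data Orb₃ {n : ℕ} (f g h : Fin n → Fin n) (x : Fin n) : Fin n → Set where
  here : Orb₃ f g h x x
  by-f : ∀ {y} → Orb₃ f g h x y → Orb₃ f g h x (f y)
  by-g : ∀ {y} → Orb₃ f g h x y → Orb₃ f g h x (g y)
  by-h : ∀ {y} → Orb₃ f g h x y → Orb₃ f g h x (h y)

iter : {A : Set} → (A → A) → ℕ → A → A
iter f zero    x = x
iter f (suc k) x = f (iter f k x)

-- A map (2-cell embedded graph on a closed surface), encoded
-- combinatorially as a connected generalized map without boundary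
-- (flags = vertex/edge/face incidences, α₀ α₁ α₂ the standard
-- involutions).  Vertices, edges, faces are the orbits of
-- ⟨α₁,α₂⟩, ⟨α₀,α₂⟩, ⟨α₀,α₁⟩, given by explicit labellings onto
-- Fin V, Fin E, Fin F.

record GMap : Set where
  field
    nFlags : ℕ
    α₀ α₁ α₂ : Fin nFlags → Fin nFlags
    α₀-inv : ∀ x → α₀ (α₀ x) ≡ x
    α₁-inv : ∀ x → α₁ (α₁ x) ≡ x
    α₂-inv : ∀ x → α₂ (α₂ x) ≡ x
    α₀-fpf : ∀ x → α₀ x ≢ x
    α₁-fpf : ∀ x → α₁ x ≢ x
    α₂-fpf : ∀ x → α₂ x ≢ x
    α₀α₂-comm : ∀ x → α₀ (α₂ x) ≡ α₂ (α₀ x)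
    α₀α₂-fpf : ∀ x → α₀ (α₂ x) ≢ x
    connected : ∀ x y → Orb₃ α₀ α₁ α₂ x y
    V E F : ℕ
    vert : Fin nFlags → Fin V
    edge : Fin nFlags → Fin E
    face : Fin nFlags → Fin F
    vert-orb : ∀ x y → vert x ≡ vert y → Orb₂ α₁ α₂ x y
    orb-vert : ∀ x y → Orb₂ α₁ α₂ x y → vert x ≡ vert y
    edge-orb : ∀ x y → edge x ≡ edge y → Orb₂ α₀ α₂ x y
    orb-edge : ∀ x y → Orb₂ α₀ α₂ x y → edge x ≡ edge y
    face-orb : ∀ x y → face x ≡ face y → Orb₂ α₀ α₁ x y
    orb-face : ∀ x y → Orb₂ α₀ α₁ x y → face x ≡ face y
    vert-onto : ∀ v → ∃ λ x → vert x ≡ v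
    edge-onto : ∀ e → ∃ λ x → edge x ≡ e
    face-onto : ∀ f → ∃ λ x → face x ≡ f

module _ (G : GMap) where
  open GMap G

  Flag : Set
  Flag = Fin nFlags

  eulerChar : ℤ
  eulerChar = (+ V ℤ.- + E) ℤ.+ + F

  vdeg : Fin V → ℕ
  vdeg v = length (filter (λ x → vert x ≟ v) (allFin nFlags)) / 2

  -- degree of a face = length of facial walk = (number of flags in it) / 2
  fdeg : Fin F → ℕ
  fdeg f = length (filter (λ x → face x ≟ f) (allFin nFlags)) / 2

  -- the list (multiset) of degrees of faces incident with v, one entry
  -- per corner {x, α₁ x} at v
  faceDegsAt : Fin V → List ℕ
  faceDegsAt v =
    map (λ x → fdeg (face x))
        (filter (λ x → (vert x ≟ v) ×-dec (toℕ x <? toℕ (α₁ x))) (allFin nFlags))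

  Adj : Fin V → Fin V → Set
  Adj u w = ∃ λ x → vert x ≡ u × vert (α₀ x) ≡ w

  Simple : Set
  Simple = (∀ x → vert x ≢ vert (α₀ x))
         × (∀ x y → vert x ≡ vert y → vert (α₀ x) ≡ vert (α₀ y) → edge x ≡ edge y)

  data PathAvoiding (a b : Fin V) : Fin V → Fin V → Set where
    stop : ∀ {u} → PathAvoiding a b u u
    step : ∀ {u w t} → Adj u w → w ≢ a → w ≢ b →
           PathAvoiding a b w t → PathAvoiding a b u t

  ThreeConnected : Set
  ThreeConnected = (3 < V) ×
    (∀ a b u w → u ≢ a → u ≢ b → w ≢ a → w ≢ b → PathAvoiding a b u w)

  MinDeg3 : Set
  MinDeg3 = ∀ v → 3 ≤ vdeg v

  -- Combinatorial homotopy.  A flag x is read as the dart from vert x to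
  -- vert (α₀ x); x and α₂ x are the same dart; α₀ x is its reverse.
  -- ρ = α₁ ∘ α₀ walks along a facial boundary.
  ρ : Flag → Flag
  ρ x = α₁ (α₀ x)

  seg : Flag → ℕ → List Flag
  seg x zero    = []
  seg x (suc k) = x ∷ seg (ρ x) k

  -- homotopy of words in the 2-complex (graph + faces as discs)
  data _≈w_ : List Flag → List Flag → Set where
    ≈-refl  : ∀ {w} → w ≈w w
    ≈-sym   : ∀ {w w′} → w ≈w w′ → w′ ≈w w
    ≈-trans : ∀ {w w′ w″} → w ≈w w′ → w′ ≈w w″ → w ≈w w″
    dart    : ∀ l r x → (l ++ x ∷ r) ≈w (l ++ α₂ x ∷ r)
    backtr  : ∀ l r x → (l ++ r) ≈w (l ++ x ∷ α₀ x ∷ r)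
    facial  : ∀ l r x k → iter ρ (suc k) x ≡ x →
              (l ++ r) ≈w (l ++ seg x (suc k) ++ r)

  -- A closed curve meeting G only in vertices, described as a cyclic
  -- sequence of face-traversals (x , k): start in the corner of flag x,
  -- cross the face of x to the corner of flag ρ^k x; the next traversal
  -- starts at the vertex where this one ends.
  Traversal : Set
  Traversal = Flag × ℕ

  endFlag : Traversal → Flag
  endFlag (x , k) = iter ρ k x

  ChainOK : Flag → List Traversal → Set
  ChainOK x₀ []            = ⊤
  ChainOK x₀ (t ∷ [])      = vert (endFlag t) ≡ vert x₀
  ChainOK x₀ (t ∷ s ∷ ts)  = vert (endFlag t) ≡ vert (proj₁ s) × ChainOK x₀ (s ∷ ts)

  -- the homotopic closed walk in G (each face-traversal replaced by the
  -- facial boundary path between the two corners)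
  curveWord : List Traversal → List Flag
  curveWord []            = []
  curveWord ((x , k) ∷ ts) = seg x k ++ curveWord ts

  -- representativity ≥ 3: every closed curve meeting G in at most two
  -- points (a and b, possibly equal) is contractible
  Repr≥3 : Set
  Repr≥3 = ∀ (a b : Fin V) (t : Traversal) (ts : List Traversal) →
    ChainOK (proj₁ t) (t ∷ ts) →
    All (λ s → vert (proj₁ s) ≡ a ⊎ vert (proj₁ s) ≡ b) (t ∷ ts) →
    curveWord (t ∷ ts) ≈w []

  Polyhedral : Set
  Polyhedral = Simple × MinDeg3 × ThreeConnected × Repr≥3

data Slot : Set where
  exactly : ℕ → Slot
  atMost  : ℕ → Slot
  anyDeg  : Slot

Sat : Slot → ℕ → Set
Sat (exactly k) d = d ≡ k
Sat (atMost k)  d = d ≤ k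
Sat anyDeg      d = ⊤

private
  e : ℕ → Slot
  e = exactly
  L : Slot
  L = atMost 2518
  A : Slot
  A = anyDeg

patterns : List (List Slot)
patterns =
    (e 3 ∷ e 3 ∷ A ∷ []) ∷ (e 3 ∷ e 4 ∷ A ∷ []) ∷ (e 3 ∷ e 5 ∷ A ∷ []) ∷
    (e 3 ∷ e 6 ∷ L ∷ []) ∷ (e 3 ∷ e 7 ∷ L ∷ []) ∷ (e 3 ∷ e 8 ∷ L ∷ []) ∷
    (e 3 ∷ e 9 ∷ L ∷ []) ∷ (e 3 ∷ e 10 ∷ L ∷ []) ∷ (e 3 ∷ e 11 ∷ L ∷ []) ∷
    (e 3 ∷ e 12 ∷ L ∷ []) ∷ (e 4 ∷ e 4 ∷ A ∷ []) ∷ (e 4 ∷ e 5 ∷ L ∷ []) ∷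
    (e 4 ∷ e 6 ∷ L ∷ []) ∷ (e 4 ∷ e 7 ∷ L ∷ []) ∷ (e 4 ∷ e 8 ∷ L ∷ []) ∷
    (e 5 ∷ e 5 ∷ L ∷ []) ∷ (e 5 ∷ e 6 ∷ L ∷ []) ∷ (e 6 ∷ e 6 ∷ e 6 ∷ []) ∷
    (e 3 ∷ e 3 ∷ e 3 ∷ A ∷ []) ∷ (e 3 ∷ e 3 ∷ e 4 ∷ L ∷ []) ∷
    (e 3 ∷ e 3 ∷ e 5 ∷ L ∷ []) ∷ (e 3 ∷ e 3 ∷ e 6 ∷ e 6 ∷ []) ∷
    (e 3 ∷ e 4 ∷ e 4 ∷ e 4 ∷ []) ∷ (e 3 ∷ e 4 ∷ e 4 ∷ e 5 ∷ []) ∷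
    (e 3 ∷ e 4 ∷ e 4 ∷ e 6 ∷ []) ∷ (e 4 ∷ e 4 ∷ e 4 ∷ e 4 ∷ []) ∷
    (e 3 ∷ e 3 ∷ e 3 ∷ e 3 ∷ e 3 ∷ []) ∷ (e 3 ∷ e 3 ∷ e 3 ∷ e 3 ∷ e 4 ∷ []) ∷
    (e 3 ∷ e 3 ∷ e 3 ∷ e 3 ∷ e 5 ∷ []) ∷ (e 3 ∷ e 3 ∷ e 3 ∷ e 3 ∷ e 6 ∷ []) ∷
    (e 3 ∷ e 3 ∷ e 3 ∷ e 4 ∷ e 4 ∷ []) ∷
    (e 3 ∷ e 3 ∷ e 3 ∷ e 3 ∷ e 3 ∷ e 3 ∷ []) ∷
    []

Matches : List Slot → List ℕ → Set
Matches p ds = Σ (List ℕ) λ ds′ → ds ↭ ds′ × Pointwise Sat p ds′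

{-# OPTIONS --safe #-}
-- Discharging, with all charges scaled by 2520.  Give a vertex of degree n with incident faces
-- of degrees a₁, …, aₙ the curvature 1 − n/2 + Σ 1/aᵢ; the curvatures sum to χ.  If no vertex is
-- of a listed type, then every vertex has curvature at most −1/126, except possibly the
-- "donors", which are the (3,6,≥2519)-vertices and have slightly positive curvature.  A donor v
-- with triangle T passes a charge of 22/2520 > 1/126 + 1/2519 to the vertex v′ of T joined to it
-- along its large face and, if v′ is a donor as well, the same amount to the third vertex of T.
-- The vertices of a triangle are never all donors, so every donor ends with a net loss of at
-- least 22/2520, and a vertex that is not a donor stays at or below −1/126 after what it receives.
-- Hence χ ≤ −V/126.
module Submission where

open import Defs
open import Data.Nat using
  (ℕ; zero; suc; _+_; _*_; _/_; _⊓_; _≤_; _<_; z≤n; s≤s; _≤ᵇ_; _<ᵇ_; _≡ᵇ_; _≟_; _≤?_; _<?_)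
open import Data.Nat.Properties
open import Data.Nat.DivMod using (/-monoˡ-≤; m/n*n≤m; m*n/n≡m)
open import Data.Nat.ListAction using () renaming (sum to Σᴸ)
open import Data.Nat.ListAction.Properties using (sum-↭)
open import Data.Nat.Tactic.RingSolver using (solve-∀)
import Data.Integer as ℤ
open import Data.Integer using (∣_∣) renaming (_≤_ to _≤ℤ_; 0ℤ to 0ℤ)
import Data.Integer.Properties as ℤ
import Data.Integer.Tactic.RingSolver as ℤ-Solver
open import Data.Bool using (Bool; true; false; if_then_else_; T; T?; _∧_; _∨_)
open import Data.Bool.ListAction using (any; all)
open import Data.Bool.Properties using (T-∧; T-∨)
open import Data.Unit using (tt)
open import Data.Fin using (Fin; toℕ) renaming (zero to fzero; suc to fsuc)
import Data.Fin.Properties as Fin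
open import Data.Fin.Permutation using (permutation)
open import Data.List using (List; []; _∷_; map; filter; length; allFin; tabulate; upTo)
open import Data.List.Properties using (length-map; map-∘; ≡-dec)
open import Data.List.Membership.Propositional using (_∈_; find; lose)
open import Data.List.Membership.Propositional.Properties using (∈-upTo⁺)
open import Data.List.Relation.Unary.All as All using (All; []; _∷_)
import Data.List.Relation.Unary.All.Properties as All
open import Data.List.Relation.Unary.Any as Any using (Any; here; there)
import Data.List.Relation.Unary.Any.Properties as Any
open import Data.List.Relation.Unary.AllPairs using ([]; _∷_)
open import Data.List.Relation.Unary.Linked as Linked using (Linked; []; [-]; _∷_)
import Data.List.Relation.Unary.Linked.Properties as Linked
open import Data.List.Relation.Unary.Unique.Propositional using (Unique)
open import Data.List.Relation.Binary.Pointwise using (Pointwise; []; _∷_)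
open import Data.List.Relation.Binary.Permutation.Propositional using (↭-sym)
open import Data.List.Relation.Binary.Permutation.Propositional.Properties
  using (↭-length; All-resp-↭) renaming (map⁺ to ↭-map⁺)
open import Data.List.Sort ≤-decTotalOrder using (sort; sort-↭; sort-↗)
open import Data.Product using (Σ; _×_; _,_; proj₁; proj₂)
open import Data.Sum using (_⊎_; inj₁; inj₂; fromInj₂)
open import Function using (_∘_; Equivalence)
open import Relation.Nullary using (¬_; Dec; yes; no; does; contradiction)
open import Relation.Nullary.Decidable
  using (toWitness; dec-true; dec-false; _×-dec_; _⊎-dec_; _→-dec_)
open import Relation.Unary using (Decidable)
open import Relation.Binary.Definitions using (tri<; tri≈; tri>)
open import Relation.Binary.PropositionalEquality
open import Algebra.Properties.Semiring.Sum +-*-semiring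
  using (sum; sum-cong-≗; ∑-distrib-+; ∑-comm; sum-permute; *-distribʳ-sum)

private variable
  n m : ℕ
  P Q : Set

-- Indicators, finite sums and multiplicities.

ind : Dec P → ℕ
ind d = if does d then 1 else 0

ind-yes : (d : Dec P) → P → ind d ≡ 1
ind-yes d p rewrite dec-true d p = refl

ind-no : (d : Dec P) → ¬ P → ind d ≡ 0
ind-no d p rewrite dec-false d p = refl

ind-mono : (d : Dec P) (e : Dec Q) → (P → Q) → ind d ≤ ind e
ind-mono (yes p) e f rewrite dec-true e (f p) = ≤-refl
ind-mono (no _)  e f = z≤n

ind≤1 : (d : Dec P) → ind d ≤ 1
ind≤1 (yes _) = ≤-refl
ind≤1 (no _)  = z≤n

ind-× : (d : Dec P) (e : Dec Q) → ind (d ×-dec e) ≡ ind d * ind e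
ind-× (yes _) (yes _) = refl
ind-× (yes _) (no _)  = refl
ind-× (no _)  _       = refl

sum-mono : (f g : Fin n → ℕ) → (∀ i → f i ≤ g i) → sum f ≤ sum g
sum-mono {zero}  f g h = z≤n
sum-mono {suc n} f g h = +-mono-≤ (h fzero) (sum-mono (f ∘ fsuc) (g ∘ fsuc) (h ∘ fsuc))

sum-const : ∀ n k → sum {n} (λ _ → k) ≡ n * k
sum-const zero    k = refl
sum-const (suc n) k = cong (k +_) (sum-const n k)

sum-zero : (f : Fin n → ℕ) → (∀ i → f i ≡ 0) → sum f ≡ 0
sum-zero {n} f h = trans (sum-cong-≗ h) (trans (sum-const n 0) (*-zeroʳ n))

sum-δ : (i : Fin n) (f : Fin n → ℕ) → sum (λ j → ind (i Fin.≟ j) * f j) ≡ f i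
sum-δ {suc n} fzero f = trans
  (cong₂ _+_ (+-identityʳ (f fzero)) (sum-zero {n} (λ _ → 0) (λ _ → refl)))
  (+-identityʳ (f fzero))
sum-δ {suc n} (fsuc i) f = sum-δ i (f ∘ fsuc)

sum-involution : (σ : Fin n → Fin n) → (∀ x → σ (σ x) ≡ x) → (f : Fin n → ℕ) →
                 sum (f ∘ σ) ≡ sum f
sum-involution σ inv f = sym (sum-permute f (permutation σ σ inv inv))

sum-filter : {A : Set} {P : A → Set} (P? : Decidable P) (g : A → ℕ) (h : Fin n → A) →
             Σᴸ (map g (filter P? (tabulate h))) ≡ sum (λ i → ind (P? (h i)) * g (h i))
sum-filter {zero}  P? g h = refl
sum-filter {suc n} P? g h with does (P? (h fzero))
... | true  = cong₂ _+_ (sym (+-identityʳ (g (h fzero)))) (sum-filter P? g (h ∘ fsuc))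
... | false = sum-filter P? g (h ∘ fsuc)

length≡sum : {A : Set} (xs : List A) → length xs ≡ Σᴸ (map (λ _ → 1) xs)
length≡sum []       = refl
length≡sum (x ∷ xs) = cong suc (length≡sum xs)

occurrences : Fin n → List (Fin n) → ℕ
occurrences x ys = Σᴸ (map (λ y → ind (y Fin.≟ x)) ys)

-- Turns a sum over a list into a sum over all of `Fin n` weighted by multiplicity. Bounds for
-- duplicate-free lists and for lists containing the support then reduce to comparing multiplicities
-- with 1 pointwise.
sum-occurrences : (ys : List (Fin n)) (f : Fin n → ℕ) →
                  sum (λ x → occurrences x ys * f x) ≡ Σᴸ (map f ys)
sum-occurrences {n} []   f = sum-zero {n} (λ _ → 0) λ _ → refl
sum-occurrences (y ∷ ys) f = begin
  sum (λ x → (ind (y Fin.≟ x) + occurrences x ys) * f x)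
    ≡⟨ sum-cong-≗ (λ x → *-distribʳ-+ (f x) (ind (y Fin.≟ x)) (occurrences x ys)) ⟩
  sum (λ x → ind (y Fin.≟ x) * f x + occurrences x ys * f x)
    ≡⟨ ∑-distrib-+ (λ x → ind (y Fin.≟ x) * f x) (λ x → occurrences x ys * f x) ⟩
  sum (λ x → ind (y Fin.≟ x) * f x) + sum (λ x → occurrences x ys * f x)
    ≡⟨ cong₂ _+_ (sum-δ y f) (sum-occurrences ys f) ⟩
  f y + Σᴸ (map f ys) ∎
  where open ≡-Reasoning

∈⇒1≤occurrences : {x : Fin n} {ys : List (Fin n)} → x ∈ ys → 1 ≤ occurrences x ys
∈⇒1≤occurrences {x = x} {y ∷ ys} (here refl) =
  ≤-trans (≤-reflexive (sym (ind-yes (x Fin.≟ x) refl))) (m≤m+n _ _)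
∈⇒1≤occurrences (there p) = ≤-trans (∈⇒1≤occurrences p) (m≤n+m _ _)

∉⇒occurrences≡0 : {x : Fin n} {ys : List (Fin n)} → All (x ≢_) ys → occurrences x ys ≡ 0
∉⇒occurrences≡0 [] = refl
∉⇒occurrences≡0 {x = x} {y ∷ _} (p ∷ ps) =
  cong₂ _+_ (ind-no (y Fin.≟ x) (p ∘ sym)) (∉⇒occurrences≡0 ps)

unique⇒occurrences≤1 : {x : Fin n} {ys : List (Fin n)} → Unique ys → occurrences x ys ≤ 1
unique⇒occurrences≤1 [] = z≤n
unique⇒occurrences≤1 {x = x} {y ∷ ys} (p ∷ u) with y Fin.≟ x
... | yes refl = s≤s (≤-reflexive (∉⇒occurrences≡0 p))
... | no _     = unique⇒occurrences≤1 u

sum≥unique : {ys : List (Fin n)} → Unique ys → (f : Fin n → ℕ) → Σᴸ (map f ys) ≤ sum f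
sum≥unique {ys = ys} u f = subst (_≤ sum f) (sum-occurrences ys f)
  (sum-mono _ f λ x → ≤-trans (*-monoˡ-≤ (f x) (unique⇒occurrences≤1 {ys = ys} u))
                              (≤-reflexive (*-identityˡ (f x))))

sum≤support : (ys : List (Fin n)) (f : Fin n → ℕ) → (∀ x → f x ≢ 0 → x ∈ ys) →
              sum f ≤ Σᴸ (map f ys)
sum≤support ys f supp = subst (sum f ≤_) (sum-occurrences ys f) (sum-mono f _ bound)
  where
  bound : ∀ x → f x ≤ occurrences x ys * f x
  bound x with f x in eq
  ... | zero  = z≤n
  ... | suc k = ≤-trans (≤-reflexive (sym (*-identityˡ (suc k))))
    (*-monoˡ-≤ (suc k) (∈⇒1≤occurrences {ys = ys} (supp x λ z → 1+n≢0 (trans (sym eq) z))))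

-- Sums over the fibres of a labelling.

module Fibre {N M : ℕ} (ℓ : Fin N → Fin M) where

  fib : Fin M → (Fin N → ℕ) → ℕ
  fib m f = sum λ x → ind (ℓ x Fin.≟ m) * f x

  fib-mono : ∀ m {f g} → (∀ x → ℓ x ≡ m → f x ≤ g x) → fib m f ≤ fib m g
  fib-mono m {f} {g} h = sum-mono _ _ bound
    where
    bound : ∀ x → ind (ℓ x Fin.≟ m) * f x ≤ ind (ℓ x Fin.≟ m) * g x
    bound x with ℓ x Fin.≟ m
    ... | yes p = +-monoˡ-≤ 0 (h x p)
    ... | no _  = z≤n

  fib-+ : ∀ m f g → fib m (λ x → f x + g x) ≡ fib m f + fib m g
  fib-+ m f g = trans
    (sum-cong-≗ λ x → *-distribˡ-+ (ind (ℓ x Fin.≟ m)) (f x) (g x))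
    (∑-distrib-+ (λ x → ind (ℓ x Fin.≟ m) * f x) (λ x → ind (ℓ x Fin.≟ m) * g x))

  fib-* : ∀ m f k → fib m (λ x → f x * k) ≡ fib m f * k
  fib-* m f k = trans (sum-cong-≗ λ x → sym (*-assoc (ind (ℓ x Fin.≟ m)) (f x) k))
    (sym (*-distribʳ-sum k (λ x → ind (ℓ x Fin.≟ m) * f x)))

  -- Double counting: each `x` lies in exactly one fibre. This passes from local sums at vertices,
  -- edges or faces to sums over all flags.
  fib-total : ∀ f → sum (λ m → fib m f) ≡ sum f
  fib-total f = begin
    sum (λ m → sum λ x → ind (ℓ x Fin.≟ m) * f x) ≡⟨ ∑-comm (λ m x → ind (ℓ x Fin.≟ m) * f x) ⟩
    sum (λ x → sum λ m → ind (ℓ x Fin.≟ m) * f x) ≡⟨ sum-cong-≗ (λ x → sum-δ (ℓ x) (λ _ → f x)) ⟩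
    sum f ∎
    where open ≡-Reasoning

  fib-involution : (σ : Fin N → Fin N) → (∀ x → σ (σ x) ≡ x) → (∀ x → ℓ (σ x) ≡ ℓ x) →
                   ∀ m f → fib m (f ∘ σ) ≡ fib m f
  fib-involution σ inv ℓσ m f = trans
    (sum-cong-≗ λ x → cong (λ i → ind (i Fin.≟ m) * f (σ x)) (sym (ℓσ x)))
    (sum-involution σ inv λ x → ind (ℓ x Fin.≟ m) * f x)

  fib≥unique : ∀ m {ys} → Unique ys → All (λ y → ℓ y ≡ m) ys → ∀ f →
               Σᴸ (map f ys) ≤ fib m f
  fib≥unique m {ys} u ys∈m f = ≤-trans (≤-reflexive (restrict ys∈m)) (sum≥unique u _)
    where
    restrict : ∀ {ys} → All (λ y → ℓ y ≡ m) ys →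
               Σᴸ (map f ys) ≡ Σᴸ (map (λ x → ind (ℓ x Fin.≟ m) * f x) ys)
    restrict [] = refl
    restrict {y ∷ _} (p ∷ ps) = cong₂ _+_
      (sym (trans (cong (_* f y) (ind-yes (ℓ y Fin.≟ m) p)) (*-identityˡ (f y))))
      (restrict ps)

  fib-size : ∀ m → length (filter (λ x → ℓ x Fin.≟ m) (allFin N)) ≡ fib m (λ _ → 1)
  fib-size m = trans (length≡sum (filter (λ x → ℓ x Fin.≟ m) (allFin N)))
    (sum-filter (λ x → ℓ x Fin.≟ m) (λ _ → 1) (λ x → x))

-- Degree classes, their weights and the listed patterns.

-- All degrees 13, …, 2518 are identified (as 13), and so are all degrees above 2518 (as 14).
cap : ℕ → ℕ
cap d = if d ≤ᵇ 12 then d else if d ≤ᵇ 2518 then 13 else 14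

data Capped (d : ℕ) : ℕ → Set where
  small : d ≤ 12 → Capped d d
  mid   : 13 ≤ d → d ≤ 2518 → Capped d 13
  big   : 2519 ≤ d → Capped d 14

capped : ∀ d → Capped d (cap d)
capped d with d ≤ᵇ 12 in p
... | true = small (≤ᵇ⇒≤ d 12 (subst T (sym p) tt))
... | false with d ≤ᵇ 2518 in q
...   | true  = mid (≰⇒> λ h → subst T p (≤⇒≤ᵇ h)) (≤ᵇ⇒≤ d 2518 (subst T (sym q) tt))
...   | false = big (≰⇒> λ h → subst T q (≤⇒≤ᵇ h))

-- Monotonicity keeps the classes of a sorted list of degrees sorted, so the later enumeration can
-- range over sorted lists of classes.
cap-mono : ∀ {a b} → a ≤ b → cap a ≤ cap b
cap-mono {a} {b} a≤b with cap a | capped a | cap b | capped b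
... | _ | small p | _ | small q  = a≤b
... | _ | small p | _ | mid q r  = ≤-trans p (toWitness {a? = 12 ≤? 13} _)
... | _ | small p | _ | big q    = ≤-trans p (toWitness {a? = 12 ≤? 14} _)
... | _ | mid p _ | _ | small q  = contradiction (≤-trans p (≤-trans a≤b q)) (<-irrefl refl)
... | _ | mid p _ | _ | mid q r  = ≤-refl
... | _ | mid p _ | _ | big q    = toWitness {a? = 13 ≤? 14} _
... | _ | big p   | _ | small q  = contradiction (≤-trans p (≤-trans a≤b (≤-trans q (toWitness {a? = 12 ≤? 2518} _)))) (<-irrefl refl)
... | _ | big p   | _ | mid _ r  = contradiction (≤-trans p (≤-trans a≤b r)) (<-irrefl refl)
... | _ | big p   | _ | big q    = ≤-refl

cap≤14 : ∀ d → cap d < 15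
cap≤14 d with cap d | capped d
... | _ | small p = s≤s (≤-trans p (toWitness {a? = 12 ≤? 14} _))
... | _ | mid _ _ = toWitness {a? = 13 <? 15} _
... | _ | big _   = ≤-refl

3≤cap : ∀ {d} → 3 ≤ d → 3 ≤ cap d
3≤cap = cap-mono

-- weight (cap d) = ⌈ 2520 / d ⌉ for 3 ≤ d ≤ 12; for the two classes of larger degrees the
-- smallest degree 13, respectively 2519, is used.
weight : ℕ → ℕ
weight 3  = 840
weight 4  = 630
weight 5  = 504
weight 6  = 420
weight 7  = 360
weight 8  = 315
weight 9  = 280
weight 10 = 252
weight 11 = 230
weight 12 = 210
weight 13 = 194
weight 14 = 2
weight _  = 0

-- Rounding always goes upward, so the weights overestimate the curvature: the corners of a face
-- together get at least 2520. The number 2520 is divisible by every degree up to 10 and by 12; the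
-- products to check for larger classes are 13 · 194 and 2519 · 2.
weight-bound : ∀ d → 3 ≤ d → 2520 ≤ d * weight (cap d)
weight-bound d 3≤d with cap d | capped d
... | _ | small p = toWitness {a? = allUpTo? (λ d → (3 ≤? d) →-dec (2520 ≤? d * weight d)) 13} _ (s≤s p) 3≤d
... | _ | mid p _ = ≤-trans (toWitness {a? = 2520 ≤? 13 * 194} _) (*-monoˡ-≤ 194 p)
... | _ | big p   = ≤-trans (toWitness {a? = 2520 ≤? 2519 * 2} _) (*-monoˡ-≤ 2 p)

-- A test on classes that suffices for `Sat` at every degree in the class. The condition `k ≤ᵇ 12`
-- ensures that the class determines the degree, and `2518 ≤ᵇ k` that every degree of class at most
-- 13 is allowed.
slotOK : Slot → ℕ → Bool
slotOK (exactly k) c = (c ≡ᵇ k) ∧ (k ≤ᵇ 12)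
slotOK (atMost k)  c = (c ≤ᵇ 13) ∧ (2518 ≤ᵇ k)
slotOK anyDeg      c = true

slotOK-sound : ∀ s d → T (slotOK s (cap d)) → Sat s d
slotOK-sound (exactly k) d t with Equivalence.to (T-∧ {cap d ≡ᵇ k}) t
... | p , q with cap d | capped d
...   | _ | small _ = ≡ᵇ⇒≡ _ _ p
...   | _ | mid _ _ = contradiction (subst (_≤ 12) (sym (≡ᵇ⇒≡ 13 k p)) (≤ᵇ⇒≤ k 12 q)) λ h → <-irrefl refl h
...   | _ | big _   = contradiction (subst (_≤ 12) (sym (≡ᵇ⇒≡ 14 k p)) (≤ᵇ⇒≤ k 12 q)) (<⇒≱ (toWitness {a? = 12 <? 14} _))
slotOK-sound (atMost k) d t with Equivalence.to (T-∧ {cap d ≤ᵇ 13}) t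
... | p , q with cap d | capped d
...   | _ | small r = ≤-trans r (≤-trans (toWitness {a? = 12 ≤? 2518} _) (≤ᵇ⇒≤ 2518 k q))
...   | _ | mid _ r = ≤-trans r (≤ᵇ⇒≤ 2518 k q)
...   | _ | big _   = contradiction p λ ()
slotOK-sound anyDeg d t = tt

fits : List Slot → List ℕ → Bool
fits []      []       = true
fits (s ∷ p) (c ∷ cs) = slotOK s c ∧ fits p cs
fits _       _        = false

fits-sound : ∀ p ds → T (fits p (map cap ds)) → Pointwise Sat p ds
fits-sound []      []       t = []
fits-sound (s ∷ p) (d ∷ ds) t with Equivalence.to (T-∧ {slotOK s (cap d)}) t
... | a , b = slotOK-sound s d a ∷ fits-sound p ds b

listed : List ℕ → Bool
listed cs = any (λ p → fits p cs) patterns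

caps : List ℕ → List ℕ
caps ds = map cap (sort ds)

listed-sound : ∀ ds → T (listed (caps ds)) → Σ (List Slot) λ p → p ∈ patterns × Matches p ds
listed-sound ds t with find (Any.any⁻ (λ p → fits p (caps ds)) patterns t)
... | p , p∈ , ok = p , p∈ , sort ds , ↭-sym (sort-↭ ds) , fits-sound p (sort ds) ok

sum-caps : ∀ (g : ℕ → ℕ) ds → Σᴸ (map g (caps ds)) ≡ Σᴸ (map (g ∘ cap) ds)
sum-caps g ds = trans (cong Σᴸ (sym (map-∘ (sort ds)))) (sum-↭ (↭-map⁺ (g ∘ cap) (sort-↭ ds)))

length-caps : ∀ ds → length (caps ds) ≡ length ds
length-caps ds = trans (length-map cap (sort ds)) (↭-length (sort-↭ ds))

caps≥3 : ∀ {ds} → All (3 ≤_) ds → All (3 ≤_) (caps ds)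
caps≥3 {ds} h = All.map⁺ (All.map 3≤cap (All-resp-↭ (↭-sym (sort-↭ ds)) h))

caps<15 : ∀ ds → All (_< 15) (caps ds)
caps<15 ds = All.map⁺ (All.universal cap≤14 (sort ds))

caps-↗ : ∀ ds → Linked _≤_ (caps ds)
caps-↗ ds = Linked.map⁺ (Linked.map cap-mono (sort-↗ ds))

-- Classification of vertex types: listed, donor or sufficiently negative.

totalWeight : List ℕ → ℕ
totalWeight cs = Σᴸ (map weight cs)

count : ℕ → List ℕ → ℕ
count k cs = Σᴸ (map (λ c → ind (c ≟ k)) cs)

-- Bounds how much a vertex can receive through a single triangular corner.
pressure : List ℕ → ℕ
pressure cs = if 2 ≤ᵇ count 6 cs then 2 else 2 ⊓ count 14 cs

-- Here 22 is the size of one transfer and 2540 = 2520 + 2520/126. Since 1260 = 2520/2, `Unloaded`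
-- says that 2520 times the curvature, estimated through the weights and increased by all that the
-- vertex can receive, is at most -20.
load : List ℕ → ℕ
load cs = totalWeight cs + count 3 cs * pressure cs * 22 + 2540

Unloaded : List ℕ → Set
Unloaded cs = load cs ≤ length cs * 1260

donor : List ℕ
donor = 3 ∷ 6 ∷ 14 ∷ []

isDonor : List ℕ → Bool
isDonor (3 ∷ 6 ∷ 14 ∷ []) = true
isDonor _ = false

isDonor-sound : ∀ cs → T (isDonor cs) → cs ≡ donor
isDonor-sound (3 ∷ 6 ∷ 14 ∷ []) t = refl

good : List ℕ → Bool
good cs = listed cs ∨ (isDonor cs ∨ (load cs ≤ᵇ length cs * 1260))

Good : List ℕ → Set
Good cs = T (listed cs) ⊎ cs ≡ donor ⊎ Unloaded cs

good-sound : ∀ cs → T (good cs) → Good cs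
good-sound cs t with Equivalence.to (T-∨ {listed cs}) t
... | inj₁ p = inj₁ p
... | inj₂ q with Equivalence.to (T-∨ {isDonor cs}) q
...   | inj₁ p = inj₂ (inj₁ (isDonor-sound cs p))
...   | inj₂ p = inj₂ (inj₂ (≤ᵇ⇒≤ (load cs) _ p))

-- A search tree over weakly increasing lists, where `lo` is the entry chosen last. The disjunct
-- `c <ᵇ lo` accepts at once the branches that would break the order.
allSorted : ℕ → ℕ → (List ℕ → Bool) → Bool
allSorted zero    lo P = P []
allSorted (suc k) lo P = all (λ c → (c <ᵇ lo) ∨ allSorted k c (P ∘ (c ∷_))) (upTo 15)

allSorted-sound : ∀ k lo P → T (allSorted k lo P) → ∀ cs → length cs ≡ k →
                  Linked _≤_ (lo ∷ cs) → All (_< 15) cs → T (P cs)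
allSorted-sound zero    lo P t []       refl _ _ = t
allSorted-sound (suc k) lo P t (c ∷ cs) eq (lo≤c ∷ l) (c<15 ∷ a)
  with Equivalence.to (T-∨ {c <ᵇ lo})
         (All.lookup (All.all⁺ (λ c → (c <ᵇ lo) ∨ allSorted k c (P ∘ (c ∷_))) (upTo 15) t)
                     (∈-upTo⁺ c<15))
... | inj₁ c<lo = contradiction (<ᵇ⇒< c lo c<lo) (≤⇒≯ lo≤c)
... | inj₂ t′   = allSorted-sound k c (P ∘ (c ∷_)) t′ cs (suc-injective eq) l a

module _ (g : ℕ → ℕ) (a : ℕ) where

  Σᴸ-bound : ∀ {cs} → All (λ c → g c ≤ a) cs → Σᴸ (map g cs) ≤ length cs * a
  Σᴸ-bound []       = z≤n
  Σᴸ-bound (p ∷ ps) = +-mono-≤ p (Σᴸ-bound ps)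

  -- One entry that falls short of `a` by `b` leaves this slack in the whole sum.
  Σᴸ-bound-Any : ∀ b {cs} → All (λ c → g c ≤ a) cs → Any (λ c → g c + b ≤ a) cs →
                 Σᴸ (map g cs) + b ≤ length cs * a
  Σᴸ-bound-Any b {c ∷ cs} (_ ∷ ps) (here q) =
    ≤-trans (≤-reflexive (swap (g c) _ b)) (+-mono-≤ q (Σᴸ-bound ps))
    where
    swap : ∀ x y z → x + y + z ≡ x + z + y
    swap = solve-∀
  Σᴸ-bound-Any b {c ∷ cs} (p ∷ ps) (there q) =
    ≤-trans (≤-reflexive (+-assoc (g c) _ b)) (+-mono-≤ p (Σᴸ-bound-Any b ps q))

Σᴸ-weight+count : ∀ k cs → Σᴸ (map (λ c → weight c + ind (c ≟ 3) * k) cs) ≡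
                           totalWeight cs + count 3 cs * k
Σᴸ-weight+count k []       = refl
Σᴸ-weight+count k (c ∷ cs) = trans (cong (weight c + ind (c ≟ 3) * k +_) (Σᴸ-weight+count k cs))
  (regroup (weight c) k (ind (c ≟ 3)) (totalWeight cs) (count 3 cs))
  where
  regroup : ∀ w k i W N → w + i * k + (W + N * k) ≡ w + W + (i + N) * k
  regroup = solve-∀

pressure≤2 : ∀ cs → pressure cs ≤ 2
pressure≤2 cs with 2 ≤ᵇ count 6 cs
... | true  = ≤-refl
... | false = m⊓n≤m 2 (count 14 cs)

pressure-sixes : ∀ cs → 2 ≤ count 6 cs → 2 ≤ pressure cs
pressure-sixes cs h with 2 ≤ᵇ count 6 cs | ≤⇒≤ᵇ h
... | true | _ = ≤-refl

pressure-bigs : ∀ {k} cs → k ≤ 2 → k ≤ count 14 cs → k ≤ pressure cs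
pressure-bigs cs k≤2 h with 2 ≤ᵇ count 6 cs
... | true  = k≤2
... | false = ⊓-glb k≤2 h

count≡0 : ∀ k {cs} → All (_< k) cs → count k cs ≡ 0
count≡0 k [] = refl
count≡0 k {c ∷ _} (p ∷ ps) = cong₂ _+_ (ind-no (c ≟ k) (<⇒≢ p)) (count≡0 k ps)

pressure≡0 : ∀ {cs} → All (_< 6) cs → pressure cs ≡ 0
pressure≡0 {cs} h
  rewrite count≡0 6 h
        | count≡0 14 (All.map (λ p → <-≤-trans p (toWitness {a? = 6 ≤? 14} _)) h) = refl

load-without-pressure : ∀ {cs} → All (_< 6) cs → load cs ≡ totalWeight cs + 2540
load-without-pressure {cs} h rewrite pressure≡0 h | *-zeroʳ (count 3 cs) =
  cong (_+ 2540) (+-identityʳ (totalWeight cs))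

-- A triangular corner accounts for at most 840 + 2 · 22 = 884, weight and receipts together, and no
-- other corner exceeds this. A corner of class at least 6 accounts for at most 420 = 884 - 464. The
-- remaining 2540 - 464 = 2076 is covered by 1260 - 884 = 376 from each of at least six corners.
unloaded-with≥6 : ∀ {cs} → All (_< 15) cs → Any (6 ≤_) cs → 6 ≤ length cs → Unloaded cs
unloaded-with≥6 {cs} cs<15 any6 6≤n = begin
  totalWeight cs + count 3 cs * pressure cs * 22 + 2540
    ≤⟨ +-monoˡ-≤ 2540 (+-monoʳ-≤ (totalWeight cs) (*-monoˡ-≤ 22 (*-monoʳ-≤ (count 3 cs) (pressure≤2 cs)))) ⟩
  totalWeight cs + count 3 cs * 2 * 22 + 2540
    ≡⟨ cong (λ z → totalWeight cs + z + 2540) (*-assoc (count 3 cs) 2 22) ⟩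
  totalWeight cs + count 3 cs * 44 + 2540
    ≡⟨ cong (_+ 2540) (Σᴸ-weight+count 44 cs) ⟨
  Σᴸ (map g cs) + 2540
    ≡⟨ +-assoc (Σᴸ (map g cs)) 464 2076 ⟨
  Σᴸ (map g cs) + 464 + 2076
    ≤⟨ +-mono-≤ (Σᴸ-bound-Any g 884 464 (All.map g≤884 cs<15) light)
                (≤-trans (toWitness {a? = 2076 ≤? 6 * 376} _) (*-monoˡ-≤ 376 6≤n)) ⟩
  length cs * 884 + length cs * 376
    ≡⟨ *-distribˡ-+ (length cs) 884 376 ⟨
  length cs * 1260 ∎
  where
  open ≤-Reasoning
  g : ℕ → ℕ
  g c = weight c + ind (c ≟ 3) * 44
  g≤884 : ∀ {c} → c < 15 → g c ≤ 884
  g≤884 = toWitness {a? = allUpTo? (λ c → g c ≤? 884) 15} _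
  light : Any (λ c → g c + 464 ≤ 884) cs
  light with _ , i∈ , 6≤c ← find any6 =
    lose i∈ (toWitness {a? = allUpTo? (λ c → (6 ≤? c) →-dec (g c + 464 ≤? 884)) 15} _
                       (All.lookup cs<15 i∈) 6≤c)

-- With classes below 6 only, the pressure vanishes and nothing is received. Each corner then leaves
-- 1260 - 840 = 420, and `b` is the extra slack from a corner that is not a triangle.
unloaded-small : ∀ b k {cs} → All (_< 6) cs → totalWeight cs + b ≤ length cs * 840 →
                 2540 ≤ b + k * 420 → k ≤ length cs → Unloaded cs
unloaded-small b k {cs} cs<6 W≤ 2540≤ k≤n = begin
  load cs                               ≡⟨ load-without-pressure cs<6 ⟩
  totalWeight cs + 2540                 ≤⟨ +-monoʳ-≤ (totalWeight cs) 2540≤ ⟩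
  totalWeight cs + (b + k * 420)        ≡⟨ +-assoc (totalWeight cs) b (k * 420) ⟨
  totalWeight cs + b + k * 420          ≤⟨ +-mono-≤ W≤ (*-monoˡ-≤ 420 k≤n) ⟩
  length cs * 840 + length cs * 420     ≡⟨ *-distribˡ-+ (length cs) 840 420 ⟨
  length cs * 1260                      ∎
  where open ≤-Reasoning

weight≤840 : ∀ {c} → c < 15 → weight c ≤ 840
weight≤840 = toWitness {a? = allUpTo? (λ c → weight c ≤? 840) 15} _

-- The cases are: a class at least 6; otherwise a class 4 or 5, with slack at least 840 - 630 = 210;
-- otherwise triangles only. Seven or more triangles are unloaded, and exactly six form a listed
-- type.
good-large : ∀ cs → All (3 ≤_) cs → All (_< 15) cs → 6 ≤ length cs → Good cs
good-large cs cs≥3 cs<15 6≤n with Any.any? (6 ≤?_) cs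
... | yes any6 = inj₂ (inj₂ (unloaded-with≥6 cs<15 any6 6≤n))
... | no ¬any6 with cs<6 ← All.map ≰⇒> (All.¬Any⇒All¬ cs ¬any6) | Any.any? (4 ≤?_) cs
...   | yes any4 = inj₂ (inj₂ (unloaded-small 210 6 cs<6
        (Σᴸ-bound-Any weight 840 210 (All.map weight≤840 cs<15) (Any.map light any4′))
        (toWitness {a? = 2540 ≤? 210 + 6 * 420} _) 6≤n))
  where
  light : ∀ {c} → c < 15 × 4 ≤ c → weight c + 210 ≤ 840
  light (p , q) = toWitness {a? = allUpTo? (λ c → (4 ≤? c) →-dec (weight c + 210 ≤? 840)) 15} _ p q
  any4′ : Any (λ c → c < 15 × 4 ≤ c) cs
  any4′ with _ , i∈ , q ← find any4 = lose i∈ (All.lookup cs<15 i∈ , q)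
...   | no ¬any4 with m≤n⇒m<n∨m≡n 6≤n
...     | inj₁ 7≤n = inj₂ (inj₂ (unloaded-small 0 7 cs<6
          (subst (_≤ length cs * 840) (sym (+-identityʳ (totalWeight cs)))
            (Σᴸ-bound weight 840 (All.map weight≤840 cs<15)))
          (toWitness {a? = 2540 ≤? 0 + 7 * 420} _) 7≤n))
...     | inj₂ 6≡n = inj₁ (allThree cs (sym 6≡n)
          (All.zipWith (λ (p , q) → ≤-antisym (≤-pred (≰⇒> q)) p) (cs≥3 , All.¬Any⇒All¬ cs ¬any4)))
  where
  allThree : ∀ cs → length cs ≡ 6 → All (_≡ 3) cs → T (listed cs)
  allThree _ _ (refl ∷ refl ∷ refl ∷ refl ∷ refl ∷ refl ∷ []) = tt

good-sorted : ∀ cs → Linked _≤_ cs → All (3 ≤_) cs → All (_< 15) cs → 3 ≤ length cs → Good cs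
good-sorted cs cs↗ cs≥3 cs<15 3≤n = go (length cs) refl 3≤n
  where
  ↗₃ : ∀ {cs} → Linked _≤_ cs → All (3 ≤_) cs → Linked _≤_ (3 ∷ cs)
  ↗₃ []        []      = [-]
  ↗₃ [-]       (p ∷ _) = p ∷ [-]
  ↗₃ l@(_ ∷ _) (p ∷ _) = p ∷ l
  enumerated : ∀ {k} → (∀ cs → length cs ≡ k → Linked _≤_ (3 ∷ cs) → All (_< 15) cs → T (good cs)) →
               length cs ≡ k → Good cs
  enumerated h eq = good-sound cs (h cs eq (↗₃ cs↗ cs≥3) cs<15)
  go : ∀ n → length cs ≡ n → 3 ≤ n → Good cs
  -- For degrees 3, 4 and 5 the proof `tt` stands for the evaluation of `good` on every sorted list
  -- of classes from 3 to 14.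
  go 3 eq _ = enumerated (allSorted-sound 3 3 good tt) eq
  go 4 eq _ = enumerated (allSorted-sound 4 3 good tt) eq
  go 5 eq _ = enumerated (allSorted-sound 5 3 good tt) eq
  go (suc (suc (suc (suc (suc (suc k)))))) eq _ =
    good-large cs cs≥3 cs<15 (subst (6 ≤_) (sym eq) (m≤m+n 6 k))
  go 1 eq (s≤s ())
  go 2 eq (s≤s (s≤s ()))

good-caps : ∀ ds → All (3 ≤_) ds → 3 ≤ length ds → Good (caps ds)
good-caps ds ds≥3 3≤n = good-sorted (caps ds) (caps-↗ ds) (caps≥3 ds≥3) (caps<15 ds)
  (subst (3 ≤_) (sym (length-caps ds)) 3≤n)

-- Orbits of commuting involutions and sizes of fibres.

-- Commutation at the base point `x` alone makes the four listed elements closed under both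
-- involutions. This bounds the flags of an edge, and also those of a vertex at which `α₁` and `α₂`
-- would commute.
commuting-orbit : ∀ {n} {f g : Fin n → Fin n} {x} → (∀ y → f (f y) ≡ y) → (∀ y → g (g y) ≡ y) →
                  f (g x) ≡ g (f x) → ∀ {y} → Orb₂ f g x y → y ∈ x ∷ f x ∷ g x ∷ f (g x) ∷ []
commuting-orbit ff gg comm here = here refl
commuting-orbit {f = f} {g} {x} ff gg comm (by-f o) with commuting-orbit ff gg comm o
... | here refl                         = there (here refl)
... | there (here refl)                 = here (ff x)
... | there (there (here refl))         = there (there (there (here refl)))
... | there (there (there (here refl))) = there (there (here (ff (g x))))
commuting-orbit {f = f} {g} {x} ff gg comm (by-g o) with commuting-orbit ff gg comm o
... | here refl                         = there (there (here refl))
... | there (here refl)                 = there (there (there (here (sym comm))))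
... | there (there (here refl))         = here (gg x)
... | there (there (there (here refl))) = there (here (trans (cong g comm) (gg (f x))))

module _ {n M} (ℓ : Fin n → Fin M) where
  open Fibre ℓ

  fib-size≤support : ∀ m ys → (∀ x → ℓ x ≡ m → x ∈ ys) → fib m (λ _ → 1) ≤ length ys
  fib-size≤support m ys supp = begin
    fib m (λ _ → 1)       ≤⟨ sum≤support ys _ inSupport ⟩
    Σᴸ (map (λ x → ind (ℓ x Fin.≟ m) * 1) ys) ≤⟨ Σᴸ-mono ys ⟩
    Σᴸ (map (λ _ → 1) ys) ≡⟨ length≡sum ys ⟨
    length ys             ∎
    where
    open ≤-Reasoning
    inSupport : ∀ x → ind (ℓ x Fin.≟ m) * 1 ≢ 0 → x ∈ ys
    inSupport x h with ℓ x Fin.≟ m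
    ... | yes p = supp x p
    ... | no _  = contradiction refl h
    Σᴸ-mono : ∀ ys → Σᴸ (map (λ x → ind (ℓ x Fin.≟ m) * 1) ys) ≤ Σᴸ (map (λ _ → 1) ys)
    Σᴸ-mono []       = z≤n
    Σᴸ-mono (y ∷ ys) = +-mono-≤ (≤-trans (≤-reflexive (*-identityʳ _)) (ind≤1 (ℓ y Fin.≟ m))) (Σᴸ-mono ys)

  fib-size≥unique : ∀ m {ys} → Unique ys → All (λ y → ℓ y ≡ m) ys → length ys ≤ fib m (λ _ → 1)
  fib-size≥unique m {ys} u h = subst (_≤ fib m (λ _ → 1)) (sym (length≡sum ys)) (fib≥unique m u h (λ _ → 1))

-- Flags, corners and triangles in a simple map of minimum degree 3.

module SimpleMap (G : GMap) (simple : Simple G) (minDeg : MinDeg3 G) where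
  open GMap G
  module FV = Fibre vert
  module FE = Fibre edge
  module FF = Fibre face

  vert-α₁ : ∀ x → vert (α₁ x) ≡ vert x
  vert-α₁ x = sym (orb-vert x _ (by-f here))

  vert-α₂ : ∀ x → vert (α₂ x) ≡ vert x
  vert-α₂ x = sym (orb-vert x _ (by-g here))

  face-α₀ : ∀ x → face (α₀ x) ≡ face x
  face-α₀ x = sym (orb-face x _ (by-f here))

  face-α₁ : ∀ x → face (α₁ x) ≡ face x
  face-α₁ x = sym (orb-face x _ (by-g here))

  α₁-injective : ∀ {x y} → α₁ x ≡ α₁ y → x ≡ y
  α₁-injective {x} {y} eq = trans (sym (α₁-inv x)) (trans (cong α₁ eq) (α₁-inv y))

  α₁-shift : ∀ {x y} → α₁ x ≡ y → x ≡ α₁ y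
  α₁-shift {x} eq = trans (sym (α₁-inv x)) (cong α₁ eq)

  vert-size≥6 : ∀ v → 6 ≤ FV.fib v (λ _ → 1)
  vert-size≥6 v = subst (6 ≤_) (FV.fib-size v)
    (≤-trans (*-monoˡ-≤ 2 (minDeg v)) (m/n*n≤m (length (filter (λ x → vert x Fin.≟ v) (allFin nFlags))) 2))

  edge-size≤4 : ∀ e → FE.fib e (λ _ → 1) ≤ 4
  edge-size≤4 e with edge-onto e
  ... | x , refl = fib-size≤support edge (edge x) (x ∷ α₀ x ∷ α₂ x ∷ α₀ (α₂ x) ∷ [])
    λ y eq → commuting-orbit α₀-inv α₂-inv (α₀α₂-comm x) (edge-orb x y (sym eq))

  -- Otherwise the vertex would have at most four flags, hence degree at most 2.
  α₁α₂≢α₂α₁ : ∀ x → α₁ (α₂ x) ≢ α₂ (α₁ x)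
  α₁α₂≢α₂α₁ x comm = contradiction
    (≤-trans (vert-size≥6 (vert x))
      (fib-size≤support vert (vert x) (x ∷ α₁ x ∷ α₂ x ∷ α₁ (α₂ x) ∷ [])
        λ y eq → commuting-orbit α₁-inv α₂-inv comm (vert-orb x y (sym eq))))
    λ { (s≤s (s≤s (s≤s (s≤s ())))) }

  α₂≢α₁ : ∀ x → α₂ x ≢ α₁ x
  α₂≢α₁ x eq = α₁α₂≢α₂α₁ x (trans (cong α₁ eq) (trans (α₁-inv x)
    (trans (sym (α₂-inv x)) (cong α₂ eq))))

  ≢-vert : ∀ {x y} → vert x ≢ vert y → x ≢ y
  ≢-vert h refl = h refl

  vert-α₀≢ : ∀ x → vert x ≢ vert (α₀ x)
  vert-α₀≢ = proj₁ simple

  vert-α₀α₁≢ : ∀ x → vert x ≢ vert (α₀ (α₁ x))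
  vert-α₀α₁≢ x eq = vert-α₀≢ (α₁ x) (trans (vert-α₁ x) eq)

  -- Otherwise x and α₁ x would lie on the same edge.
  vert-α₀≢α₀α₁ : ∀ x → vert (α₀ x) ≢ vert (α₀ (α₁ x))
  vert-α₀≢α₀α₁ x eq with commuting-orbit α₀-inv α₂-inv (α₀α₂-comm x)
                           (edge-orb x (α₁ x) (proj₂ simple x (α₁ x) (sym (vert-α₁ x)) eq))
  ... | here p                         = α₁-fpf x p
  ... | there (here p)                 = vert-α₀≢ x (trans (sym (vert-α₁ x)) (cong vert p))
  ... | there (there (here p))         = α₂≢α₁ x (sym p)
  ... | there (there (there (here p))) = vert-α₀≢ x
    (trans (sym (vert-α₁ x)) (trans (cong vert (trans p (α₀α₂-comm x))) (vert-α₂ (α₀ x))))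

  -- The flags of three consecutive corners of one face: the corner of `x` and the corners at its
  -- two neighbours along the face. They are distinct because the three vertices are distinct and
  -- `α₁` has no fixed point.
  hexad : Fin nFlags → List (Fin nFlags)
  hexad x = x ∷ α₁ x ∷ α₀ x ∷ α₁ (α₀ x) ∷ α₀ (α₁ x) ∷ α₁ (α₀ (α₁ x)) ∷ []

  hexad-unique : ∀ x → Unique (hexad x)
  hexad-unique x =
    (α₁-fpf x ∘ sym ∷ ne refl refl xp ∷ ne refl (vert-α₁ _) xp ∷ ne refl refl xq ∷ ne refl (vert-α₁ _) xq ∷ []) ∷
    (ne (vert-α₁ _) refl xp ∷ ne (vert-α₁ _) (vert-α₁ _) xp ∷ ne (vert-α₁ _) refl xq ∷ ne (vert-α₁ _) (vert-α₁ _) xq ∷ []) ∷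
    (α₁-fpf (α₀ x) ∘ sym ∷ ne refl refl pq ∷ ne refl (vert-α₁ _) pq ∷ []) ∷
    (ne (vert-α₁ _) refl pq ∷ ne (vert-α₁ _) (vert-α₁ _) pq ∷ []) ∷
    (α₁-fpf (α₀ (α₁ x)) ∘ sym ∷ []) ∷
    [] ∷ []
    where
    xp = vert-α₀≢ x
    xq = vert-α₀α₁≢ x
    pq = vert-α₀≢α₀α₁ x
    ne : ∀ {y z u v} → vert y ≡ u → vert z ≡ v → u ≢ v → y ≢ z
    ne refl refl h = ≢-vert h

  hexad-face : ∀ x → All (λ y → face y ≡ face x) (hexad x)
  hexad-face x = refl ∷ face-α₁ x ∷ face-α₀ x ∷ trans (face-α₁ _) (face-α₀ x) ∷
    trans (face-α₀ _) (face-α₁ x) ∷ trans (face-α₁ _) (trans (face-α₀ _) (face-α₁ x)) ∷ []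

  hexad-α₁ : ∀ {x y} → α₁ y ∈ hexad x → y ∈ hexad x
  hexad-α₁ {x} (here p) = there (here (α₁-shift p))
  hexad-α₁ {x} (there (here p)) = here (α₁-injective p)
  hexad-α₁ {x} (there (there (here p))) = there (there (there (here (α₁-shift p))))
  hexad-α₁ {x} (there (there (there (here p)))) = there (there (here (α₁-injective p)))
  hexad-α₁ {x} (there (there (there (there (here p))))) =
    there (there (there (there (there (here (α₁-shift p))))))
  hexad-α₁ {x} (there (there (there (there (there (here p)))))) =
    there (there (there (there (here (α₁-injective p)))))

  d : Fin nFlags → ℕ
  d x = fdeg G (face x)

  fdeg-half : ∀ f → fdeg G f ≡ FF.fib f (λ _ → 1) / 2
  fdeg-half f = cong (_/ 2) (FF.fib-size f)

  face-half : ∀ k x {ys} → Unique ys → All (λ y → face y ≡ face x) ys → k * 2 ≤ length ys → k ≤ d x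
  face-half k x u h k≤ = ≤-trans (≤-reflexive (sym (m*n/n≡m k 2)))
    (subst (k * 2 / 2 ≤_) (sym (fdeg-half (face x)))
      (/-monoˡ-≤ 2 (≤-trans k≤ (fib-size≥unique face (face x) u h))))

  d≥3 : ∀ x → 3 ≤ d x
  d≥3 x = face-half 3 x (hexad-unique x) (hexad-face x) ≤-refl

  -- If the flag on the left lay outside the hexad, so would its `α₁`-partner, and eight flags force
  -- degree at least 4. Inside the hexad, the other five positions contradict the distinctness of
  -- the three vertices or the absence of fixed points.
  triangle-closes : ∀ x → d x ≡ 3 → α₀ (α₁ (α₀ x)) ≡ α₁ (α₀ (α₁ x))
  triangle-closes x d≡3 with Any.any? (α₀ (α₁ (α₀ x)) Fin.≟_) (hexad x)
  ... | no ∉ = contradiction (face-half 4 x {q ∷ α₁ q ∷ hexad x}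
      ((α₁-fpf q ∘ sym ∷ All.¬Any⇒All¬ _ ∉) ∷ All.¬Any⇒All¬ _ (∉ ∘ hexad-α₁) ∷ hexad-unique x)
      (face-q ∷ trans (face-α₁ q) face-q ∷ hexad-face x) ≤-refl)
      (<⇒≱ (s≤s (≤-reflexive d≡3)))
    where
    q = α₀ (α₁ (α₀ x))
    face-q : face q ≡ face x
    face-q = trans (face-α₀ _) (trans (face-α₁ _) (face-α₀ x))
  ... | yes q∈ = inHexad q∈
    where
    α₀-shift : ∀ {y z} → α₀ y ≡ z → y ≡ α₀ z
    α₀-shift {y} eq = trans (sym (α₀-inv y)) (cong α₀ eq)
    inHexad : α₀ (α₁ (α₀ x)) ∈ hexad x → α₀ (α₁ (α₀ x)) ≡ α₁ (α₀ (α₁ x))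
    inHexad (here p) = contradiction (α₀-shift p) (α₁-fpf (α₀ x))
    inHexad (there (here p)) = contradiction
      (trans (sym (vert-α₁ (α₀ x))) (cong vert (α₀-shift p))) (vert-α₀≢α₀α₁ x)
    inHexad (there (there (here p))) = contradiction
      (trans (sym (cong vert (trans (α₀-shift p) (α₀-inv x)))) (vert-α₁ (α₀ x))) (vert-α₀≢ x)
    inHexad (there (there (there (here p)))) = contradiction p (α₀-fpf (α₁ (α₀ x)))
    inHexad (there (there (there (there (here p))))) = contradiction
      (trans (sym (vert-α₁ x)) (trans (cong vert (sym (trans (α₀-shift p) (α₀-inv (α₁ x))))) (vert-α₁ (α₀ x))))
      (vert-α₀≢ x)
    inHexad (there (there (there (there (there (here p)))))) = p

  -- Classes of the faces around a vertex.

  c : Fin nFlags → ℕ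
  c x = cap (d x)

  c-face : ∀ {x y} → face x ≡ face y → c x ≡ c y
  c-face = cong (cap ∘ fdeg G)

  c-α₀ : ∀ x → c (α₀ x) ≡ c x
  c-α₀ x = c-face (face-α₀ x)

  c-α₁ : ∀ x → c (α₁ x) ≡ c x
  c-α₁ x = c-face (face-α₁ x)

  -- The face across the edge of `x` is the same seen from either end.
  c-α₂α₀ : ∀ x → c (α₂ (α₀ x)) ≡ c (α₂ x)
  c-α₂α₀ x = trans (cong c (sym (α₀α₂-comm x))) (c-α₀ (α₂ x))

  d≡3 : ∀ {x} → c x ≡ 3 → d x ≡ 3
  d≡3 {x} eq with cap (d x) | capped (d x)
  ... | _ | small _ = eq

  isCorner? : ∀ v x → Dec (vert x ≡ v × toℕ x < toℕ (α₁ x))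
  isCorner? v x = (vert x Fin.≟ v) ×-dec (toℕ x <? toℕ (α₁ x))

  corners : Fin V → List (Fin nFlags)
  corners v = filter (isCorner? v) (allFin nFlags)

  capsAt : Fin V → List ℕ
  capsAt v = caps (faceDegsAt G v)

  smaller-flag : ∀ x → ind (toℕ x <? toℕ (α₁ x)) + ind (toℕ (α₁ x) <? toℕ x) ≡ 1
  smaller-flag x with <-cmp (toℕ x) (toℕ (α₁ x))
  ... | tri< a _ b = cong₂ _+_ (ind-yes (toℕ x <? toℕ (α₁ x)) a) (ind-no (toℕ (α₁ x) <? toℕ x) b)
  ... | tri≈ _ a _ = contradiction (sym (Fin.toℕ-injective a)) (α₁-fpf x)
  ... | tri> a _ b = cong₂ _+_ (ind-no (toℕ x <? toℕ (α₁ x)) a) (ind-yes (toℕ (α₁ x) <? toℕ x) b)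

  -- A corner consists of the two flags `x` and `α₁ x`, exactly one of which is the smaller and
  -- represents it in `corners`.
  fib-corners : ∀ v f → (∀ x → f (α₁ x) ≡ f x) → FV.fib v f ≡ 2 * Σᴸ (map f (corners v))
  fib-corners v f f-α₁ = begin
    sum (λ x → ind (vert x Fin.≟ v) * f x)      ≡⟨ sum-cong-≗ split ⟩
    sum (λ x → h x + h (α₁ x))                  ≡⟨ ∑-distrib-+ h (h ∘ α₁) ⟩
    sum h + sum (h ∘ α₁)                        ≡⟨ cong (sum h +_) (sum-involution α₁ α₁-inv h) ⟩
    sum h + sum h                               ≡⟨ cong (sum h +_) (+-identityʳ (sum h)) ⟨
    2 * sum h                                   ≡⟨ cong (2 *_) (sum-filter (isCorner? v) f (λ x → x)) ⟨
    2 * Σᴸ (map f (corners v))                  ∎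
    where
    open ≡-Reasoning
    h : Fin nFlags → ℕ
    h x = ind (isCorner? v x) * f x
    distribute : ∀ a b b′ y → a * b * y + a * b′ * y ≡ a * (b + b′) * y
    distribute = solve-∀
    split : ∀ x → ind (vert x Fin.≟ v) * f x ≡ h x + h (α₁ x)
    split x = sym (begin
      h x + h (α₁ x)
        ≡⟨ cong₂ (λ i j → i * f x + j * f (α₁ x))
             (ind-× (vert x Fin.≟ v) (toℕ x <? toℕ (α₁ x)))
             (ind-× (vert (α₁ x) Fin.≟ v) (toℕ (α₁ x) <? toℕ (α₁ (α₁ x)))) ⟩
      i * j * f x + ind (vert (α₁ x) Fin.≟ v) * ind (toℕ (α₁ x) <? toℕ (α₁ (α₁ x))) * f (α₁ x)
        ≡⟨ cong (i * j * f x +_) (cong₂ _*_ (cong₂ (λ u y → ind (u Fin.≟ v) * ind (toℕ (α₁ x) <? toℕ y))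
             (vert-α₁ x) (α₁-inv x)) (f-α₁ x)) ⟩
      i * j * f x + i * j′ * f x
        ≡⟨ distribute i j j′ (f x) ⟩
      i * (j + j′) * f x
        ≡⟨ cong (λ k → i * k * f x) (smaller-flag x) ⟩
      i * 1 * f x
        ≡⟨ cong (_* f x) (*-identityʳ i) ⟩
      i * f x ∎)
      where
      i j j′ : ℕ
      i  = ind (vert x Fin.≟ v)
      j  = ind (toℕ x <? toℕ (α₁ x))
      j′ = ind (toℕ (α₁ x) <? toℕ x)

  fib-caps : ∀ g v → FV.fib v (g ∘ c) ≡ 2 * Σᴸ (map g (capsAt v))
  fib-caps g v = begin
    FV.fib v (g ∘ c)                              ≡⟨ fib-corners v (g ∘ c) (λ x → cong g (c-α₁ x)) ⟩
    2 * Σᴸ (map (g ∘ c) (corners v))              ≡⟨ cong (λ z → 2 * Σᴸ z) (map-∘ (corners v)) ⟩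
    2 * Σᴸ (map (g ∘ cap) (faceDegsAt G v))       ≡⟨ cong (2 *_) (sum-caps g (faceDegsAt G v)) ⟨
    2 * Σᴸ (map g (capsAt v))                     ∎
    where open ≡-Reasoning

  fib-size-caps : ∀ v → FV.fib v (λ _ → 1) ≡ 2 * length (capsAt v)
  fib-size-caps v = trans (fib-caps (λ _ → 1) v) (cong (2 *_) (sym (length≡sum (capsAt v))))

  good-vertex : ∀ v → Good (capsAt v)
  good-vertex v = good-caps (faceDegsAt G v) (All.map⁺ (All.universal d≥3 (corners v)))
    (subst (3 ≤_) (length-caps (faceDegsAt G v))
      (*-cancelˡ-≤ 2 (subst (6 ≤_) (fib-size-caps v) (vert-size≥6 v))))

  count≥ : ∀ k v ys → Unique ys → All (λ y → vert y ≡ v) ys → All (λ y → c y ≡ k) ys →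
           length ys ≤ 2 * count k (capsAt v)
  count≥ k v ys u ys∈v ys∈k = subst₂ _≤_ (trans (indicator ys∈k) (sym (length≡sum ys)))
    (fib-caps (λ e → ind (e ≟ k)) v) (FV.fib≥unique v u ys∈v (λ y → ind (c y ≟ k)))
    where
    indicator : ∀ {ys} → All (λ y → c y ≡ k) ys →
                Σᴸ (map (λ y → ind (c y ≟ k)) ys) ≡ Σᴸ (map (λ _ → 1) ys)
    indicator []           = refl
    indicator {y ∷ _} (p ∷ ps) = cong₂ _+_ (ind-yes (c y ≟ k) p) (indicator ps)

  one-corner : ∀ {k v} x → vert x ≡ v → c x ≡ k → 1 ≤ count k (capsAt v)
  one-corner {k} {v} x p q = *-cancelˡ-≤ 2 (count≥ k v (x ∷ α₁ x ∷ [])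
    ((α₁-fpf x ∘ sym ∷ []) ∷ [] ∷ [])
    (p ∷ trans (vert-α₁ x) p ∷ []) (q ∷ trans (c-α₁ x) q ∷ []))

  two-corners : ∀ {k v} x y → vert x ≡ v → vert y ≡ v → x ≢ y → α₁ x ≢ y →
                c x ≡ k → c y ≡ k → 2 ≤ count k (capsAt v)
  two-corners {k} {v} x y p p′ x≢y αx≢y q q′ = *-cancelˡ-≤ 2 (count≥ k v
    (x ∷ α₁ x ∷ y ∷ α₁ y ∷ [])
    ((α₁-fpf x ∘ sym ∷ x≢y ∷ αx≢y ∘ sym ∘ (λ h → trans (sym (α₁-inv y)) (cong α₁ (sym h))) ∷ []) ∷
     (αx≢y ∷ x≢y ∘ α₁-injective ∷ []) ∷ (α₁-fpf y ∘ sym ∷ []) ∷ [] ∷ [])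
    (p ∷ trans (vert-α₁ x) p ∷ p′ ∷ trans (vert-α₁ y) p′ ∷ [])
    (q ∷ trans (c-α₁ x) q ∷ q′ ∷ trans (c-α₁ y) q′ ∷ []))

  -- The corners on either side of the corner of `x` are different because `α₁` and `α₂` do not
  -- commute at `x`, which is where degree at least 3 enters.
  two-sides : ∀ {k} x → c (α₂ x) ≡ k → c (α₂ (α₁ x)) ≡ k → 2 ≤ count k (capsAt (vert x))
  two-sides x = two-corners (α₂ x) (α₂ (α₁ x)) (vert-α₂ x) (trans (vert-α₂ (α₁ x)) (vert-α₁ x))
    (λ h → α₁-fpf x (sym (α₂-injective h))) (α₁α₂≢α₂α₁ x)
    where
    α₂-injective : ∀ {y z} → α₂ y ≡ α₂ z → y ≡ z
    α₂-injective {y} {z} h = trans (sym (α₂-inv y)) (trans (cong α₂ h) (α₂-inv z))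

  corner-and-side : ∀ {k} x → c x ≡ k → c (α₂ x) ≡ k → 2 ≤ count k (capsAt (vert x))
  corner-and-side x = two-corners x (α₂ x) refl (vert-α₂ x) (α₂-fpf x ∘ sym) (α₂≢α₁ x ∘ sym)

  -- Donors and their transfers.

  Donor : Fin V → Set
  Donor v = capsAt v ≡ donor

  Donor? : ∀ v → Dec (Donor v)
  Donor? v = ≡-dec _≟_ (capsAt v) donor

  donor-class : ∀ {x} → Donor (vert x) → c x ≡ 3 ⊎ c x ≡ 6 ⊎ c x ≡ 14
  donor-class {x} D with 3 ≟ c x | 6 ≟ c x | 14 ≟ c x
                       | subst (λ cs → 1 ≤ count (c x) cs) D (one-corner x refl refl)
  ... | yes p | _     | _     | _ = inj₁ (sym p)
  ... | no _  | yes p | _     | _ = inj₂ (inj₁ (sym p))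
  ... | no _  | no _  | yes p | _ = inj₂ (inj₂ (sym p))
  ... | no p  | no q  | no r  | h = contradiction
    (subst (1 ≤_) (cong₂ _+_ (ind-no (3 ≟ c x) p) (cong₂ _+_ (ind-no (6 ≟ c x) q)
      (cong (_+ 0) (ind-no (14 ≟ c x) r)))) h) λ ()

  donor-once : ∀ {v} k → Donor v → k ≡ 3 ⊎ k ≡ 6 ⊎ k ≡ 14 → ¬ (2 ≤ count k (capsAt v))
  donor-once {v} k D k∈ h with capsAt v | D | k∈
  ... | _ | refl | inj₁ refl        = contradiction h λ { (s≤s ()) }
  ... | _ | refl | inj₂ (inj₁ refl) = contradiction h λ { (s≤s ()) }
  ... | _ | refl | inj₂ (inj₂ refl) = contradiction h λ { (s≤s ()) }

  Opposite : ℕ → ℕ → Set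
  Opposite a b = (a ≡ 14 × b ≡ 6) ⊎ (a ≡ 6 × b ≡ 14)

  -- The corner of `x` and the two corners beside it are pairwise different, and a donor has each of
  -- the classes 3, 6 and 14 only once, so every repetition is excluded.
  donor-sides : ∀ {x} → Donor (vert x) → c x ≡ 3 →
                Opposite (c (α₂ x)) (c (α₂ (α₁ x)))
  donor-sides {x} D p
    with donor-class {α₂ x} (subst Donor (sym (vert-α₂ x)) D)
       | donor-class {α₂ (α₁ x)} (subst Donor (sym (trans (vert-α₂ (α₁ x)) (vert-α₁ x))) D)
  ... | inj₁ q        | _             = contradiction (corner-and-side x p q) (donor-once 3 D (inj₁ refl))
  ... | inj₂ _        | inj₁ r        = contradiction (corner-and-side (α₁ x) (trans (c-α₁ x) p) r)
                                          (donor-once 3 (subst Donor (sym (vert-α₁ x)) D) (inj₁ refl))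
  ... | inj₂ (inj₁ q) | inj₂ (inj₁ r) = contradiction (two-sides x q r) (donor-once 6 D (inj₂ (inj₁ refl)))
  ... | inj₂ (inj₁ q) | inj₂ (inj₂ r) = inj₂ (q , r)
  ... | inj₂ (inj₂ q) | inj₂ (inj₁ r) = inj₁ (q , r)
  ... | inj₂ (inj₂ q) | inj₂ (inj₂ r) = contradiction (two-sides x q r) (donor-once 14 D (inj₂ (inj₂ refl)))

  14≢6 : ∀ {n : ℕ} → n ≡ 14 → n ≢ 6
  14≢6 refl ()

  -- The flag x stands for the transfer from vert x to vert (α₀ x); in the second case
  -- vert (α₀ (α₁ x)) is the vertex reached from vert x along its large face.
  Sends : Fin nFlags → Set
  Sends x = Donor (vert x) × c x ≡ 3 × (c (α₂ x) ≡ 14 ⊎ (c (α₂ x) ≡ 6 × Donor (vert (α₀ (α₁ x)))))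

  Sends? : ∀ x → Dec (Sends x)
  Sends? x = Donor? (vert x) ×-dec (c x ≟ 3) ×-dec
    ((c (α₂ x) ≟ 14) ⊎-dec ((c (α₂ x) ≟ 6) ×-dec Donor? (vert (α₀ (α₁ x)))))

  out into : Fin nFlags → ℕ
  out x = ind (Sends? x)
  into x = out (α₀ x)


  module _ {x : Fin nFlags} (c≡3 : c x ≡ 3) where

    third-vertex : vert (α₀ (α₁ (α₀ x))) ≡ vert (α₀ (α₁ x))
    third-vertex = trans (cong vert (triangle-closes x (d≡3 c≡3))) (vert-α₁ (α₀ (α₁ x)))

    donor-sides-α₀ : Donor (vert (α₀ x)) → Opposite (c (α₂ x)) (c (α₂ (α₁ (α₀ x))))
    donor-sides-α₀ D = subst (λ s → Opposite s (c (α₂ (α₁ (α₀ x))))) (c-α₂α₀ x)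
      (donor-sides D (trans (c-α₀ x) c≡3))

    donor-sides-α₀α₁ : Donor (vert (α₀ (α₁ x))) → Opposite (c (α₂ (α₁ x))) (c (α₂ (α₁ (α₀ x))))
    donor-sides-α₀α₁ D = subst₂ Opposite (c-α₂α₀ (α₁ x))
      (trans (cong (c ∘ α₂) (sym (triangle-closes x (d≡3 c≡3)))) (c-α₂α₀ (α₁ (α₀ x))))
      (donor-sides D (trans (c-α₀ (α₁ x)) (trans (c-α₁ x) c≡3)))

    -- The three outer faces of the triangle would be pairwise different, each of class 6 or 14.
    ¬three-donors : Donor (vert x) → Donor (vert (α₀ x)) → ¬ Donor (vert (α₀ (α₁ x)))
    ¬three-donors D D′ D″ with donor-sides D c≡3 | donor-sides-α₀ D′ | donor-sides-α₀α₁ D″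
    ... | inj₁ (p , q) | _            | inj₁ (r , _) = 14≢6 r q
    ... | inj₁ (p , q) | inj₁ (_ , r) | inj₂ (_ , t) = 14≢6 t r
    ... | inj₁ (p , q) | inj₂ (r , _) | inj₂ _       = 14≢6 p r
    ... | inj₂ (p , q) | _            | inj₂ (r , _) = 14≢6 q r
    ... | inj₂ (p , q) | inj₁ (r , _) | inj₁ _       = 14≢6 r p
    ... | inj₂ (p , q) | inj₂ (_ , r) | inj₁ (_ , t) = 14≢6 r t

    -- In the second case of `Sends` the sender and the third vertex are donors joined along a large
    -- face. The hexagon of each then lies across its edge to `vert x`. This is why `pressure` looks
    -- at two sixes as well as at large faces.
    receives : Sends (α₀ x) → c (α₂ x) ≡ 14 ⊎ (c (α₂ x) ≡ 6 × c (α₂ (α₁ x)) ≡ 6)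
    receives (D , _ , inj₁ p) = inj₁ (trans (sym (c-α₂α₀ x)) p)
    receives (D , _ , inj₂ (p , D′))
      with donor-sides-α₀ D | donor-sides-α₀α₁ (subst Donor third-vertex D′)
    ... | inj₁ (q , _) | _            = inj₁ q
    ... | inj₂ (q , _) | inj₂ (r , _) = inj₂ (q , r)
    ... | inj₂ (_ , q) | inj₁ (_ , r) = contradiction r (14≢6 q)

    -- The donor `vert x` sends along its large face. Nothing arrives from the third vertex: the
    -- edge between them borders a hexagon, and the other case of `Sends` would make all three
    -- vertices donors. If something arrives from `vert (α₀ x)`, that vertex is a donor, and
    -- `vert x` sends to the third vertex as well.
    donor-balance-at-14 : Donor (vert x) → c (α₂ x) ≡ 14 → into x + into (α₁ x) + 1 ≤ out x + out (α₁ x)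
    donor-balance-at-14 D p = begin
      into x + into (α₁ x) + 1  ≡⟨ cong (λ i → into x + i + 1) (ind-no (Sends? (α₀ (α₁ x))) ¬sends) ⟩
      into x + 0 + 1            ≡⟨ cong (_+ 1) (+-identityʳ (into x)) ⟩
      into x + 1                ≡⟨ +-comm (into x) 1 ⟩
      1 + into x                ≡⟨ cong (_+ into x) (ind-yes (Sends? x) (D , c≡3 , inj₁ p)) ⟨
      out x + into x            ≤⟨ +-monoʳ-≤ (out x) (ind-mono (Sends? (α₀ x)) (Sends? (α₁ x)) returns) ⟩
      out x + out (α₁ x)        ∎
      where
      open ≤-Reasoning
      side-6 : c (α₂ (α₁ x)) ≡ 6
      side-6 with donor-sides D c≡3
      ... | inj₁ (_ , q) = q
      ... | inj₂ (q , _) = contradiction q (14≢6 p)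
      ¬sends : ¬ Sends (α₀ (α₁ x))
      ¬sends (D″ , _ , inj₁ q) = 14≢6 q (trans (c-α₂α₀ (α₁ x)) side-6)
      ¬sends (D″ , _ , inj₂ (_ , D′)) = ¬three-donors D (subst Donor
        (trans (cong (vert ∘ α₀) (sym (triangle-closes x (d≡3 c≡3))))
               (trans (cong vert (α₀-inv (α₁ (α₀ x)))) (vert-α₁ (α₀ x)))) D′) D″
      returns : Sends (α₀ x) → Sends (α₁ x)
      returns (D′ , _) = subst Donor (sym (vert-α₁ x)) D , trans (c-α₁ x) c≡3 ,
        inj₂ (side-6 , subst (Donor ∘ vert ∘ α₀) (sym (α₁-inv x)) D′)

  out-triangle : ∀ x → c x ≢ 3 → out x ≡ 0
  out-triangle x h = ind-no (Sends? x) λ (_ , p , _) → h p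

  into-triangle : ∀ x → c x ≢ 3 → into x ≡ 0
  into-triangle x h = out-triangle (α₀ x) λ p → h (trans (sym (c-α₀ x)) p)

  -- By `receives`, a transfer either needs a large face across its own edge or needs hexagons on
  -- both sides of the corner. Two transfers therefore need two large corners or two hexagons at the
  -- vertex.
  into-corner : ∀ x → into x + into (α₁ x) ≤ ind (c x ≟ 3) * pressure (capsAt (vert x))
  into-corner x = byClass (c x ≟ 3)
    where
    byClass : (t : Dec (c x ≡ 3)) → into x + into (α₁ x) ≤ ind t * pressure (capsAt (vert x))
    byClass (no c≢3) = ≤-reflexive (cong₂ _+_ (into-triangle x c≢3)
                     (into-triangle (α₁ x) (λ p → c≢3 (trans (sym (c-α₁ x)) p))))
    byClass (yes c≡3) = ≤-trans (atMost₂ (Sends? (α₀ x)) (Sends? (α₀ (α₁ x))))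
                            (≤-reflexive (sym (+-identityʳ (pressure cs))))
      where
      cs = capsAt (vert x)
      sixes : c (α₂ x) ≡ 6 → c (α₂ (α₁ x)) ≡ 6 → 2 ≤ pressure cs
      sixes p q = pressure-sixes cs (two-sides x p q)
      receives′ : Sends (α₀ (α₁ x)) → c (α₂ (α₁ x)) ≡ 14 ⊎ (c (α₂ (α₁ x)) ≡ 6 × c (α₂ x) ≡ 6)
      receives′ S with receives {α₁ x} (trans (c-α₁ x) c≡3) S
      ... | inj₁ p       = inj₁ p
      ... | inj₂ (p , q) = inj₂ (p , trans (cong (c ∘ α₂) (sym (α₁-inv x))) q)
      atMost₂ : (s : Dec (Sends (α₀ x))) (s′ : Dec (Sends (α₀ (α₁ x)))) → ind s + ind s′ ≤ pressure cs
      atMost₂ (no _)  (no _) = z≤n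
      atMost₂ (yes S) (no _) with receives c≡3 S
      ... | inj₁ p       = pressure-bigs cs (s≤s z≤n) (one-corner (α₂ x) (vert-α₂ x) p)
      ... | inj₂ (p , q) = ≤-trans (s≤s z≤n) (sixes p q)
      atMost₂ (no _) (yes S) with receives′ S
      ... | inj₁ p       = pressure-bigs cs (s≤s z≤n)
                             (one-corner (α₂ (α₁ x)) (trans (vert-α₂ (α₁ x)) (vert-α₁ x)) p)
      ... | inj₂ (q , p) = ≤-trans (s≤s z≤n) (sixes p q)
      atMost₂ (yes S) (yes S′) with receives c≡3 S | receives′ S′
      ... | inj₂ (p , q) | _            = sixes p q
      ... | inj₁ _       | inj₂ (q , p) = sixes p q
      ... | inj₁ p       | inj₁ q       = pressure-bigs cs ≤-refl (two-sides x p q)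

  -- Balance of charges at a vertex.

  fib-pair : ∀ v f → FV.fib v (λ x → f x + f (α₁ x)) ≡ 2 * FV.fib v f
  fib-pair v f = begin
    FV.fib v (λ x → f x + f (α₁ x))   ≡⟨ FV.fib-+ v f (f ∘ α₁) ⟩
    FV.fib v f + FV.fib v (f ∘ α₁)    ≡⟨ cong (FV.fib v f +_) (FV.fib-involution α₁ α₁-inv vert-α₁ v f) ⟩
    FV.fib v f + FV.fib v f           ≡⟨ cong (FV.fib v f +_) (+-identityʳ (FV.fib v f)) ⟨
    2 * FV.fib v f                    ∎
    where open ≡-Reasoning

  fib-triangles : ∀ v → FV.fib v (λ x → ind (c x ≟ 3)) ≡ 2 * count 3 (capsAt v)
  fib-triangles v = fib-caps (λ k → ind (k ≟ 3)) v

  into-bound : ∀ v → FV.fib v into ≤ count 3 (capsAt v) * pressure (capsAt v)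
  into-bound v = *-cancelˡ-≤ 2 (begin
    2 * FV.fib v into                                     ≡⟨ fib-pair v into ⟨
    FV.fib v (λ x → into x + into (α₁ x))                 ≤⟨ FV.fib-mono v (λ { x refl → into-corner x }) ⟩
    FV.fib v (λ x → ind (c x ≟ 3) * p)                    ≡⟨ FV.fib-* v (λ x → ind (c x ≟ 3)) p ⟩
    FV.fib v (λ x → ind (c x ≟ 3)) * p                    ≡⟨ cong (_* p) (fib-triangles v) ⟩
    2 * count 3 (capsAt v) * p                            ≡⟨ *-assoc 2 (count 3 (capsAt v)) p ⟩
    2 * (count 3 (capsAt v) * p)                          ∎)
    where
    open ≤-Reasoning
    p : ℕ
    p = pressure (capsAt v)

  donor-corner : ∀ x → Donor (vert x) → into x + into (α₁ x) + ind (c x ≟ 3) ≤ out x + out (α₁ x)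
  donor-corner x D = byClass (c x ≟ 3)
    where
    byClass : (t : Dec (c x ≡ 3)) → into x + into (α₁ x) + ind t ≤ out x + out (α₁ x)
    byClass (no c≢3) = ≤-trans (≤-reflexive (trans (+-identityʳ _) (cong₂ _+_ (into-triangle x c≢3)
      (into-triangle (α₁ x) (λ p → c≢3 (trans (sym (c-α₁ x)) p)))))) z≤n
    byClass (yes c≡3) with donor-sides D c≡3
    ... | inj₁ (p , _) = donor-balance-at-14 c≡3 D p
    -- The large face lies across the other edge of the corner, so `x` and `α₁ x` exchange roles.
    ... | inj₂ (_ , p) = subst₂ _≤_
      (cong (_+ 1) (trans (cong (λ y → into (α₁ x) + into y) (α₁-inv x)) (+-comm (into (α₁ x)) (into x))))
      (trans (cong (λ y → out (α₁ x) + out y) (α₁-inv x)) (+-comm (out (α₁ x)) (out x)))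
      (donor-balance-at-14 (trans (c-α₁ x) c≡3) (subst Donor (sym (vert-α₁ x)) D) p)

  donor-bound : ∀ v → Donor v → FV.fib v into + 1 ≤ FV.fib v out
  donor-bound v D = *-cancelˡ-≤ 2 (begin
    2 * (FV.fib v into + 1)              ≡⟨ *-distribˡ-+ 2 (FV.fib v into) 1 ⟩
    2 * FV.fib v into + 2                ≡⟨ cong₂ _+_ (fib-pair v into)
                                              (trans (fib-triangles v) (cong (λ cs → 2 * count 3 cs) D)) ⟨
    FV.fib v (λ x → into x + into (α₁ x)) + FV.fib v (λ x → ind (c x ≟ 3))
      ≡⟨ FV.fib-+ v (λ x → into x + into (α₁ x)) (λ x → ind (c x ≟ 3)) ⟨
    FV.fib v (λ x → into x + into (α₁ x) + ind (c x ≟ 3))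
      ≤⟨ FV.fib-mono v (λ { x refl → donor-corner x D }) ⟩
    FV.fib v (λ x → out x + out (α₁ x))  ≡⟨ fib-pair v out ⟩
    2 * FV.fib v out                     ∎)
    where open ≤-Reasoning

  -- Summing over flags counts every corner twice, hence doubles all charges. A transfer sits on a
  -- single flag, so it is entered as 44 = 2 · 22.
  demand supply : Fin nFlags → ℕ
  demand x = weight (c x) + into x * 44
  supply x = 1260 + out x * 44

  fib-demand : ∀ v → FV.fib v demand ≡ 2 * (totalWeight (capsAt v) + FV.fib v into * 22)
  fib-demand v = begin
    FV.fib v demand
      ≡⟨ FV.fib-+ v (weight ∘ c) (λ x → into x * 44) ⟩
    FV.fib v (weight ∘ c) + FV.fib v (λ x → into x * 44)
      ≡⟨ cong₂ _+_ (fib-caps weight v) (FV.fib-* v into 44) ⟩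
    2 * totalWeight (capsAt v) + FV.fib v into * 44
      ≡⟨ double (totalWeight (capsAt v)) (FV.fib v into) 22 ⟩
    2 * (totalWeight (capsAt v) + FV.fib v into * 22) ∎
    where
    open ≡-Reasoning
    double : ∀ w i k → 2 * w + i * (2 * k) ≡ 2 * (w + i * k)
    double = solve-∀

  fib-supply : ∀ v → FV.fib v supply ≡ 2 * (length (capsAt v) * 1260 + FV.fib v out * 22)
  fib-supply v = begin
    FV.fib v supply
      ≡⟨ FV.fib-+ v (λ _ → 1 * 1260) (λ x → out x * 44) ⟩
    FV.fib v (λ _ → 1 * 1260) + FV.fib v (λ x → out x * 44)
      ≡⟨ cong₂ _+_ (FV.fib-* v (λ _ → 1) 1260) (FV.fib-* v out 44) ⟩
    FV.fib v (λ _ → 1) * 1260 + FV.fib v out * 44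
      ≡⟨ cong (λ n → n * 1260 + FV.fib v out * 44) (fib-size-caps v) ⟩
    2 * length (capsAt v) * 1260 + FV.fib v out * 44
      ≡⟨ double (length (capsAt v)) (FV.fib v out) 1260 22 ⟩
    2 * (length (capsAt v) * 1260 + FV.fib v out * 22) ∎
    where
    open ≡-Reasoning
    double : ∀ l o j k → 2 * l * j + o * (2 * k) ≡ 2 * (l * j + o * k)
    double = solve-∀

  vertex-bound : ∀ v → Donor v ⊎ Unloaded (capsAt v) →
                 totalWeight (capsAt v) + FV.fib v into * 22 + 2540 ≤
                 length (capsAt v) * 1260 + FV.fib v out * 22
  vertex-bound v (inj₂ U) = begin
    totalWeight cs + FV.fib v into * 22 + 2540
      ≤⟨ +-monoˡ-≤ 2540 (+-monoʳ-≤ (totalWeight cs) (*-monoˡ-≤ 22 (into-bound v))) ⟩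
    load cs                                  ≤⟨ U ⟩
    length cs * 1260                         ≤⟨ m≤m+n (length cs * 1260) (FV.fib v out * 22) ⟩
    length cs * 1260 + FV.fib v out * 22     ∎
    where
    open ≤-Reasoning
    cs = capsAt v
  vertex-bound v (inj₁ D) = begin
    totalWeight (capsAt v) + i * 22 + 2540
      ≡⟨ cong (λ cs → totalWeight cs + i * 22 + 2540) D ⟩
    -- The donor weights give 1262 = 840 + 420 + 2, and 3 · 1260 = 3780. Since 1262 + 2540 = 3780 +
    -- 22, a net loss of one transfer is exactly enough.
    1262 + i * 22 + 2540                     ≡⟨ cong (_+ 2540) (+-comm 1262 (i * 22)) ⟩
    i * 22 + 1262 + 2540                     ≡⟨ +-assoc (i * 22) 1262 2540 ⟩
    i * 22 + 3802                            ≡⟨ +-assoc (i * 22) (1 * 22) 3780 ⟨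
    i * 22 + 1 * 22 + 3780                   ≡⟨ cong (_+ 3780) (*-distribʳ-+ 22 i 1) ⟨
    (i + 1) * 22 + 3780                      ≤⟨ +-monoˡ-≤ 3780 (*-monoˡ-≤ 22 (donor-bound v D)) ⟩
    FV.fib v out * 22 + 3780                 ≡⟨ +-comm (FV.fib v out * 22) 3780 ⟩
    3780 + FV.fib v out * 22
      ≡⟨ cong (λ cs → length cs * 1260 + FV.fib v out * 22) D ⟨
    length (capsAt v) * 1260 + FV.fib v out * 22 ∎
    where
    open ≤-Reasoning
    i : ℕ
    i = FV.fib v into

  vertex-balance : ∀ v → Donor v ⊎ Unloaded (capsAt v) → FV.fib v demand + 5080 ≤ FV.fib v supply
  vertex-balance v h = begin
    FV.fib v demand + 5080
      ≡⟨ cong (_+ 5080) (fib-demand v) ⟩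
    2 * (totalWeight (capsAt v) + FV.fib v into * 22) + 2 * 2540
      ≡⟨ *-distribˡ-+ 2 (totalWeight (capsAt v) + FV.fib v into * 22) 2540 ⟨
    2 * (totalWeight (capsAt v) + FV.fib v into * 22 + 2540)
      ≤⟨ *-monoʳ-≤ 2 (vertex-bound v h) ⟩
    2 * (length (capsAt v) * 1260 + FV.fib v out * 22)
      ≡⟨ fib-supply v ⟨
    FV.fib v supply ∎
    where open ≤-Reasoning

  -- Summation over vertices, edges and faces.

  face-weight : ∀ f → 5040 ≤ FF.fib f (weight ∘ c)
  face-weight f with face-onto f
  ... | x , refl = begin
    2 * 2520                                        ≤⟨ *-monoʳ-≤ 2 (weight-bound (d x) (d≥3 x)) ⟩
    2 * (d x * weight (c x))                        ≡⟨ regroup (d x) (weight (c x)) ⟩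
    d x * 2 * weight (c x)                          ≤⟨ *-monoˡ-≤ (weight (c x)) d*2≤ ⟩
    FF.fib (face x) (λ _ → 1) * weight (c x)        ≡⟨ FF.fib-* (face x) (λ _ → 1) (weight (c x)) ⟨
    FF.fib (face x) (λ _ → 1 * weight (c x))        ≤⟨ FF.fib-mono (face x) (λ y p → ≤-reflexive
                                                        (trans (+-identityʳ _) (cong weight (c-face (sym p))))) ⟩
    FF.fib (face x) (weight ∘ c)                    ∎
    where
    open ≤-Reasoning
    regroup : ∀ a b → 2 * (a * b) ≡ a * 2 * b
    regroup = solve-∀
    d*2≤ : d x * 2 ≤ FF.fib (face x) (λ _ → 1)
    d*2≤ = subst (λ z → z * 2 ≤ FF.fib (face x) (λ _ → 1)) (sym (fdeg-half (face x)))
      (m/n*n≤m (FF.fib (face x) (λ _ → 1)) 2)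

  total-weight : F * 5040 ≤ sum (weight ∘ c)
  total-weight = subst₂ _≤_ (sum-const F 5040) (FF.fib-total (weight ∘ c))
    (sum-mono (λ _ → 5040) (λ f → FF.fib f (weight ∘ c)) face-weight)

  flags≤ : nFlags ≤ E * 4
  flags≤ = subst₂ _≤_ (trans (FE.fib-total (λ _ → 1)) (trans (sum-const nFlags 1) (*-identityʳ nFlags)))
    (sum-const E 4) (sum-mono (λ e → FE.fib e (λ _ → 1)) (λ _ → 4) edge-size≤4)

  sum-demand : sum demand ≡ sum (weight ∘ c) + sum out * 44
  sum-demand = begin
    sum demand                                    ≡⟨ ∑-distrib-+ (weight ∘ c) (λ x → into x * 44) ⟩
    sum (weight ∘ c) + sum (λ x → into x * 44)    ≡⟨ cong (sum (weight ∘ c) +_) (*-distribʳ-sum 44 into) ⟨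
    sum (weight ∘ c) + sum into * 44
      -- Reversing flags by `α₀` matches receipts with payments, so both totals agree.
      ≡⟨ cong (λ z → sum (weight ∘ c) + z * 44) (sum-involution α₀ α₀-inv out) ⟩
    sum (weight ∘ c) + sum out * 44               ∎
    where open ≡-Reasoning

  sum-supply : sum supply ≡ nFlags * 1260 + sum out * 44
  sum-supply = begin
    sum supply                                    ≡⟨ ∑-distrib-+ (λ _ → 1260) (λ x → out x * 44) ⟩
    sum {nFlags} (λ _ → 1260) + sum (λ x → out x * 44)
      ≡⟨ cong₂ _+_ (sum-const nFlags 1260) (sym (*-distribʳ-sum 44 out)) ⟩
    nFlags * 1260 + sum out * 44                  ∎
    where open ≡-Reasoning

  -- In the sum of the vertex balances the transfers cancel. Each face contributes weight at least
  -- 5040 = 2 · 2520, and each edge has at most four flags, worth 4 · 1260 = 5040.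
  euler-bound : (∀ v → Donor v ⊎ Unloaded (capsAt v)) → F * 5040 + V * 5080 ≤ E * 5040
  euler-bound h = +-cancelʳ-≤ (sum out * 44) _ _ (begin
    F * 5040 + V * 5080 + sum out * 44
      ≤⟨ +-monoˡ-≤ (sum out * 44) (+-monoˡ-≤ (V * 5080) total-weight) ⟩
    sum (weight ∘ c) + V * 5080 + sum out * 44
      ≡⟨ swap (sum (weight ∘ c)) (V * 5080) (sum out * 44) ⟩
    sum (weight ∘ c) + sum out * 44 + V * 5080
      ≡⟨ cong₂ _+_ (trans (sym sum-demand) (sym (FV.fib-total demand))) (sym (sum-const V 5080)) ⟩
    sum (λ v → FV.fib v demand) + sum {V} (λ _ → 5080)
      ≡⟨ ∑-distrib-+ (λ v → FV.fib v demand) (λ _ → 5080) ⟨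
    sum (λ v → FV.fib v demand + 5080)
      ≤⟨ sum-mono (λ v → FV.fib v demand + 5080) (λ v → FV.fib v supply) (λ v → vertex-balance v (h v)) ⟩
    sum (λ v → FV.fib v supply)
      ≡⟨ trans (FV.fib-total supply) sum-supply ⟩
    nFlags * 1260 + sum out * 44
      ≤⟨ +-monoˡ-≤ (sum out * 44) (*-monoˡ-≤ 1260 flags≤) ⟩
    E * 4 * 1260 + sum out * 44
      ≡⟨ cong (_+ sum out * 44) (*-assoc E 4 1260) ⟩
    E * 5040 + sum out * 44 ∎)
    where
    open ≤-Reasoning
    swap : ∀ x y z → x + y + z ≡ x + z + y
    swap = solve-∀

-- F·5040 + V·5080 ≤ E·5040 says V ≤ 126 (E − V − F).
few-vertices : ∀ V E F → F * 5040 + V * 5080 ≤ E * 5040 → V ≤ 126 * ∣ (ℤ.+ V ℤ.- ℤ.+ E) ℤ.+ ℤ.+ F ∣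
few-vertices V E F h with m≤n⇒∃[o]m+o≡n V+F≤E
  where
  V+F≤E : V + F ≤ E
  V+F≤E = *-cancelʳ-≤ (V + F) E 5040 (begin
    (V + F) * 5040         ≡⟨ cong (_* 5040) (+-comm V F) ⟩
    (F + V) * 5040         ≡⟨ *-distribʳ-+ 5040 F V ⟩
    F * 5040 + V * 5040    ≤⟨ +-monoʳ-≤ (F * 5040) (*-monoʳ-≤ V (toWitness {a? = 5040 ≤? 5080} _)) ⟩
    F * 5040 + V * 5080    ≤⟨ h ⟩
    E * 5040               ∎)
    where open ≤-Reasoning
... | k , refl = subst (λ z → V ≤ 126 * z) (sym ∣χ∣≡k) (*-cancelʳ-≤ V (126 * k) 40
      (+-cancelˡ-≤ (F * 5040 + V * 5040) _ _ (begin
        F * 5040 + V * 5040 + V * 40          ≡⟨ +-assoc (F * 5040) (V * 5040) (V * 40) ⟩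
        F * 5040 + (V * 5040 + V * 40)        ≡⟨ cong (F * 5040 +_) (*-distribˡ-+ V 5040 40) ⟨
        F * 5040 + V * 5080                   ≤⟨ h ⟩
        (V + F + k) * 5040                    ≡⟨ expand V F k 5040 ⟩
        -- Each vertex has the surplus 40 = 5080 - 5040, and 5040 = 126 · 40 produces the constant
        -- of the theorem.
        F * 5040 + V * 5040 + k * 5040        ≡⟨ cong (F * 5040 + V * 5040 +_) (*-assoc k 126 40) ⟨
        F * 5040 + V * 5040 + k * 126 * 40    ≡⟨ cong (λ z → F * 5040 + V * 5040 + z * 40) (*-comm k 126) ⟩
        F * 5040 + V * 5040 + 126 * k * 40    ∎)))
  where
  open ≤-Reasoning
  expand : ∀ v f k n → (v + f + k) * n ≡ f * n + v * n + k * n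
  expand = solve-∀
  cancel : ∀ v f k → (v ℤ.- ((v ℤ.+ f) ℤ.+ k)) ℤ.+ f ≡ ℤ.- k
  cancel = ℤ-Solver.solve-∀
  ∣χ∣≡k : ∣ (ℤ.+ V ℤ.- ℤ.+ (V + F + k)) ℤ.+ ℤ.+ F ∣ ≡ k
  ∣χ∣≡k = trans (cong ∣_∣ (cancel (ℤ.+ V) (ℤ.+ F) (ℤ.+ k))) (ℤ.∣-i∣≡∣i∣ (ℤ.+ k))

theorem2 : (G : GMap) → Polyhedral G → eulerChar G ≤ℤ 0ℤ →
    126 * ∣ eulerChar G ∣ < GMap.V G →
    Σ (Fin (GMap.V G)) λ v → Σ (List Slot) λ p → p ∈ patterns × Matches p (faceDegsAt G v)
theorem2 G (simple , minDeg , _) _ many = search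
  where
  open SimpleMap G simple minDeg
  search : Σ (Fin (GMap.V G)) λ v → Σ (List Slot) λ p → p ∈ patterns × Matches p (faceDegsAt G v)
  search with Fin.any? (λ v → T? (listed (capsAt v)))
  ... | yes (v , l) = v , listed-sound (faceDegsAt G v) l
  ... | no ¬listed = contradiction
    (few-vertices (GMap.V G) (GMap.E G) (GMap.F G) (euler-bound λ v →
      fromInj₂ (λ l → contradiction (v , l) ¬listed) (good-vertex v)))
    (<⇒≱ many)
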